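{- Let $c$ be a fixed constant and let $G$ be the (connected) input graph. If a set $X$ of $k$ vertices of $G$ such that $G-X$ is efficiently $\alpha_c$-dominated can be found in $\mathcal{O}^*(f(k))$ time, then INDEPENDENT CUTSET can be solved in $\mathcal{O}^*(f(k)+3^k)$ time.
   Context: All graphs are finite, simple, loopless and undirected. A set $S$ of vertices of a graph $G$ is a cutset of $G$ if $G-S$ is disconnected; it is an independent set if its vertices are pairwise nonadjacent. An independent cutset of $G$ is a set of vertices that is both a cutset and an independent set of $G$. INDEPENDENT CUTSET is the decision problem: given a connected graph $G$, does $G$ have an independent cutset? A dominating set of $G$ is a set of vertices $X$ such that every vertex of $G$ is in $X$ or has a neighbor in $X$. $\alpha(G[X])$ denotes the independence number (maximum size of an independent set) of the subgraph induced by $X$. A set of vertices $X$ is an $\alpha_k$-dominating set of $G$ if $X$ is a dominating set of $G$ and $\alpha(G[X])\le k$. If $G$ admits an $\alpha_k$-dominating set, $G$ is called $\alpha_k$-dominated; if in addition such a set can be computed in polynomial time, $G$ is called efficiently $\alpha_k$-dominated. The notation $\mathcal{O}^*$ is the $\mathcal{O}$-notation with factors polynomial in the input size suppressed. -}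

module Defs where

open import Data.Bool using (Bool; true; false; T)
open import Data.Bool.Properties using (T?)
open import Data.Fin using (Fin; zero; suc)
open import Data.Fin.Properties using (all?)
open import Data.Fin.Subset using (Subset; inside; outside; _∈_; ∣_∣; ∁)
open import Data.Fin.Subset.Properties using (_∈?_)
open import Data.List using (List; []; _∷_; _++_; map; filter)
open import Data.List.Extrema.Nat using (max)
open import Data.Nat using (ℕ; zero; suc; _+_; _*_; _^_; _≤_)
open import Data.Product using (_×_; ∃-syntax)
open import Data.Sum using (_⊎_)
open import Data.Vec using (Vec; []; _∷_; tabulate)
open import Level using (0ℓ)
open import Relation.Binary.Construct.Closure.ReflexiveTransitive using (Star)
open import Relation.Binary.PropositionalEquality using (_≡_)
open import Relation.Nullary using (¬_; Dec; Reflects)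
open import Relation.Nullary.Decidable using (¬?; _→-dec_)
open import Relation.Unary using (Pred)

------------------------------------------------------------------------
-- Graphs

record Graph : Set where
  field
    order       : ℕ
    adj         : Fin order → Fin order → Bool
    symmetric   : ∀ u v → adj u v ≡ adj v u
    irreflexive : ∀ v → adj v v ≡ false

open Graph public

Vertex : Graph → Set
Vertex G = Fin (order G)

VertexSet : Graph → Set
VertexSet G = Subset (order G)

Adjacent : (G : Graph) → Vertex G → Vertex G → Set
Adjacent G u v = T (adj G u v)

GraphClass : Set₁
GraphClass = Pred Graph 0ℓ

-- The i-th smallest element of a subset of Fin n.
nth : ∀ {n} (S : Subset n) → Fin ∣ S ∣ → Fin n
nth (inside  ∷ S) zero    = zero
nth (inside  ∷ S) (suc i) = suc (nth S i)
nth (outside ∷ S) i       = suc (nth S i)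

-- Induced subgraph; its vertices are renumbered 0, 1, … in the order
-- inherited from G.
infixl 8 _[_] _−_

_[_] : (G : Graph) → VertexSet G → Graph
G [ S ] = record
  { order       = ∣ S ∣
  ; adj         = λ i j → adj G (nth S i) (nth S j)
  ; symmetric   = λ i j → symmetric G (nth S i) (nth S j)
  ; irreflexive = λ i → irreflexive G (nth S i)
  }

_−_ : (G : Graph) → VertexSet G → Graph
G − S = G [ ∁ S ]

-- Any two vertices are joined by a walk.  In particular the graph
-- without vertices is not disconnected, so V(G) is not a cutset.
Connected : GraphClass
Connected G = ∀ u v → Star (Adjacent G) u v

Disconnected : GraphClass
Disconnected G = ¬ Connected G

Cutset : (G : Graph) → VertexSet G → Set
Cutset G S = Disconnected (G − S)

Independent : (G : Graph) → VertexSet G → Set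
Independent G S = ∀ u v → u ∈ S → v ∈ S → ¬ Adjacent G u v

HasIndependentCutset : GraphClass
HasIndependentCutset G = ∃[ S ] (Cutset G S × Independent G S)

Independent? : ∀ G S → Dec (Independent G S)
Independent? G S = all? λ u → all? λ v →
  (u ∈? S) →-dec ((v ∈? S) →-dec ¬? (T? (adj G u v)))

subsets : ∀ n → List (Subset n)
subsets zero    = [] ∷ []
subsets (suc n) = map (outside ∷_) (subsets n) ++ map (inside ∷_) (subsets n)

-- Independence number.
α : Graph → ℕ
α G = max 0 (map ∣_∣ (filter (Independent? G) (subsets (order G))))

Dominating : (G : Graph) → VertexSet G → Set
Dominating G X = ∀ v → v ∈ X ⊎ (∃[ u ] (u ∈ X × Adjacent G v u))

αDominating : ℕ → (G : Graph) → VertexSet G → Set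
αDominating k G X = Dominating G X × α (G [ X ]) ≤ k

------------------------------------------------------------------------
-- Model of computation
--
-- Algorithms are while-programs over binary trees, in the style of
-- Jones' language WHILE (in a variable-free form: a program transforms
-- a single tree, which plays the role of the store).  The operations
-- are constant-time pointer operations and a test against nil, each of
-- unit cost, so the model is Turing-complete and its running times agree
-- with those of Turing machines up to a polynomial.

infixr 6 _∙_

data Tree : Set where
  nil : Tree
  _∙_ : Tree → Tree → Tree

left right : Tree → Tree
left  nil     = nil
left  (x ∙ y) = x
right nil     = nil
right (x ∙ y) = y

infixr 5 _⨾_

data Program : Set where
  skip nil hd tl : Program
  cons           : Program → Program → Program
  _⨾_            : Program → Program → Program
  if_then_else_  : Program → Program → Program → Program
  while_loop_    : Program → Program → Program

-- P ⊢ x ⇓[ t ] y: started on x, the program P halts after t steps with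
-- result y.  Tests take nil for false and every other tree for true.
infix 4 _⊢_⇓[_]_

data _⊢_⇓[_]_ : Program → Tree → ℕ → Tree → Set where
  skip : ∀ {x} → skip ⊢ x ⇓[ 1 ] x
  nil  : ∀ {x} → nil ⊢ x ⇓[ 1 ] nil
  hd   : ∀ {x} → hd ⊢ x ⇓[ 1 ] left x
  tl   : ∀ {x} → tl ⊢ x ⇓[ 1 ] right x
  cons : ∀ {P Q x y z s t} →
         P ⊢ x ⇓[ s ] y → Q ⊢ x ⇓[ t ] z →
         cons P Q ⊢ x ⇓[ 1 + s + t ] y ∙ z
  seq  : ∀ {P Q x y z s t} →
         P ⊢ x ⇓[ s ] y → Q ⊢ y ⇓[ t ] z →
         P ⨾ Q ⊢ x ⇓[ 1 + s + t ] z
  if-true     : ∀ {B P Q x b b′ y s t} →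
                B ⊢ x ⇓[ s ] b ∙ b′ → P ⊢ x ⇓[ t ] y →
                if B then P else Q ⊢ x ⇓[ 1 + s + t ] y
  if-false    : ∀ {B P Q x y s t} →
                B ⊢ x ⇓[ s ] nil → Q ⊢ x ⇓[ t ] y →
                if B then P else Q ⊢ x ⇓[ 1 + s + t ] y
  while-true  : ∀ {B P x b b′ y z s t u} →
                B ⊢ x ⇓[ s ] b ∙ b′ → P ⊢ x ⇓[ t ] y →
                while B loop P ⊢ y ⇓[ u ] z →
                while B loop P ⊢ x ⇓[ 1 + s + t + u ] z
  while-false : ∀ {B P x s} →
                B ⊢ x ⇓[ s ] nil →
                while B loop P ⊢ x ⇓[ 1 + s ] x

------------------------------------------------------------------------
-- Encodings: a graph is presented by its adjacency matrix, a vertex set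
-- by its characteristic vector.

encodeBool : Bool → Tree
encodeBool false = nil
encodeBool true  = nil ∙ nil

encodeVec : ∀ {A : Set} {n} → (A → Tree) → Vec A n → Tree
encodeVec enc []       = nil
encodeVec enc (x ∷ xs) = enc x ∙ encodeVec enc xs

encodeSubset : ∀ {n} → Subset n → Tree
encodeSubset = encodeVec encodeBool

encodeGraph : Graph → Tree
encodeGraph G =
  encodeVec (encodeVec encodeBool) (tabulate λ u → tabulate λ v → adj G u v)

------------------------------------------------------------------------
-- Time bounds

-- Some program, run on any graph G of the class 𝒢, produces a tree y with
-- R G y in time g G · C · (1 + |V(G)|)^d, where the constants C and d do
-- not depend on G.  This is time 𝒪*(g): the encoding of G has size between
-- |V(G)| and a constant times (1 + |V(G)|)², so "polynomial in the input
-- size" and "polynomial in |V(G)|" mean the same.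
Solvable𝒪* : (g : Graph → ℕ) (𝒢 : GraphClass) (R : Graph → Tree → Set) → Set
Solvable𝒪* g 𝒢 R =
  ∃[ P ] ∃[ C ] ∃[ d ] ∀ G → 𝒢 G →
  ∃[ y ] ∃[ t ] (P ⊢ encodeGraph G ⇓[ t ] y
               × R G y
               × t ≤ g G * (C * suc (order G) ^ d))

SolvableInPolynomialTime : (𝒢 : GraphClass) (R : Graph → Tree → Set) → Set
SolvableInPolynomialTime = Solvable𝒪* (λ _ → 1)

OutputsSet : ((G : Graph) → VertexSet G → Set) → Graph → Tree → Set
OutputsSet Q G y = ∃[ X ] (y ≡ encodeSubset X × Q G X)

Decides : GraphClass → Graph → Tree → Set
Decides Q G y = ∃[ b ] (y ≡ encodeBool b × Reflects (Q G) b)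

-- "Computable in polynomial time" is a property of a class of graphs,
-- not of a single graph: one algorithm must serve all members of 𝒟.
EfficientlyαDominated : ℕ → GraphClass → Set
EfficientlyαDominated c 𝒟 =
  SolvableInPolynomialTime 𝒟 (OutputsSet (αDominating c))

DeletionSet : GraphClass → (Graph → ℕ) → (G : Graph) → VertexSet G → Set
DeletionSet 𝒟 k G X = ∣ X ∣ ≡ k G × 𝒟 (G − X)

{-# OPTIONS --safe #-}
module Submission where

-- An independent cutset is a colouring of the vertices by cut, side₁ and
-- side₂ that uses both sides and has no edge inside cut or between the
-- sides.  Branch over the 3^k colourings of the deletion set X.  Let D be
-- the dominating set of G − X with α(G[D]) ≤ c.  In every colour the
-- vertices of D contain a maximal independent set of size at most c, so
-- polynomially many guesses of at most 3c coloured vertices include these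
-- three sets; they determine the colouring on D, since a vertex of D in a
-- side has a neighbour in the set of its side, and all cut vertices of D
-- are guessed.  As D dominates G − X, every other vertex has a coloured
-- neighbour and thus at most two possible colours, which leaves a 2-SAT
-- instance, solved by eliminating one vertex after the other.
--
-- The programs for the polynomial-time parts come from combinators that
-- produce a program together with polynomial bounds on its running time
-- and on the size of its output; only the branching on X is a hand-written
-- loop, driven by a stack of partial colourings.

open import Defs
open import Data.Bool using (Bool; true; false; _∧_; _∨_; not; T)
open import Data.Bool.ListAction using (any; all)
open import Data.Bool.Properties using (T?; T-≡; ∨-identityʳ)
open import Data.Empty using (⊥-elim)
open import Data.Fin using (Fin; zero; suc; toℕ)
open import Data.Fin.Properties as Finₚ using (toℕ-injective; any?; sequence)
open import Data.Fin.Subset using (Subset; inside; outside; _∈_; _∉_; _∪_; ⁅_⁆; ∣_∣; ∁) renaming (⊥ to ∅)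
open import Data.Fin.Subset.Properties using (_∈?_; x∈∁p⇒x∉p; x∉p⇒x∈∁p; x∈p∪q⁻; x∈p∪q⁺; x∈⁅x⁆; x∈⁅y⁆⇒x≡y; ∉⊥; ∣p∣≤n)
open import Data.List as List using (List; []; _∷_; _++_; _ʳ++_; map; foldl; foldr; reverse; filterᵇ; concatMap; cartesianProduct; length; replicate; downFrom; applyUpTo; allFin)
open import Data.List.Extrema.Nat using (v≤max⁺)
import Data.List.Membership.DecPropositional as DecMembership
open import Data.List.Membership.Propositional using (find; lose) renaming (_∈_ to _∈ˡ_)
open import Data.List.Membership.Propositional.Properties using (∈-allFin; ∈-++⁺ˡ; ∈-++⁺ʳ; ∈-++⁻; ∈-map⁺; ∈-map⁻; ∈-filter⁺; ∈-filter⁻; ∈-tabulate⁺; ∈-tabulate⁻; ∈-cartesianProduct⁺; ∈-cartesianProduct⁻)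
open import Data.List.Properties using (++-identityʳ; reverse-foldl; map-is-foldr; ++-is-foldr; reverse-downFrom; map-tabulate; length-tabulate; length-++; length-++-≤ˡ)
open import Data.List.Relation.Unary.All as All using (All; []; _∷_)
open import Data.List.Relation.Unary.All.Properties using (all⁺; all⁻; ¬All⇒Any¬)
open import Data.List.Relation.Unary.Any using (here; there)
open import Data.List.Relation.Unary.Any.Properties using (any⁺; any⁻; map⁺; reverseAcc⁺; reverseAcc⁻)
open import Data.Nat using (ℕ; zero; suc; _+_; _*_; _^_; _≤_; z≤n; s≤s; s≤s⁻¹; _≡ᵇ_)
open import Data.Nat.Properties
open import Data.Nat.Tactic.RingSolver using (solve-∀)
open import Data.Product using (Σ; ∃-syntax; _×_; _,_; proj₁; proj₂)
open import Data.Product.Properties using (≡-dec)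
open import Data.Sum using (_⊎_; inj₁; inj₂; [_,_]′)
open import Data.Unit using (⊤; tt)
open import Data.Vec as Vec using (Vec; []; _∷_; lookup; tabulate; toList; here; there)
open import Data.Vec.Properties using (lookup∘tabulate; lookup⇒[]=; []=⇒lookup; length-toList; toList-map)
open import Effect.Monad using (RawMonad)
open import Function using (_∘_; id; flip; Equivalence)
open import Level using (0ℓ)
open import Relation.Binary using (DecidableEquality)
open import Relation.Binary.Construct.Closure.ReflexiveTransitive using (Star; ε; _◅_; _◅◅_)
open import Relation.Binary.PropositionalEquality using (_≡_; _≢_; refl; sym; trans; cong; cong₂; subst)
open import Relation.Nullary using (¬_; Dec; yes; no)
open import Relation.Nullary.Decidable using (_×-dec_; decidable-stable; ¬¬-excluded-middle)
open import Relation.Nullary.Negation using (¬¬-Monad)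
open import Relation.Nullary.Reflects using (fromEquivalence)
open import Relation.Unary using (Decidable; _⊆_)

-- Polynomials

-- A coloured neighbour leaves two colours because every colour forbids exactly one: cut forbids
-- cut, and each side forbids the other. The cut class is itself independent, so a maximal
-- independent set inside it is the whole class on D; hence a vertex of D that is not guessed as cut
-- can be assumed to lie in a side. An accepted guess always produces an actual colouring, so
-- domination and the bound on α enter through completeness. In every colour the guessed set is
-- independent in the graph induced by D, which is the only way in which α limits the number of
-- guesses.
--
-- The two kinds of guessing are compiled differently. The 3c guesses are constant in number and
-- become nested loops when the program is built. The depth k of the branching is known only at run
-- time and needs a stack; depth-first traversal keeps the stack polynomial although exponentially
-- many nodes are visited.

infixl 6 _⊕_
infixl 7 _⊗_
infixr 9 _⊚_

-- Syntax instead of functions: composition is a constructor and every term is monotone by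
-- induction, so bounds of composite programs are assembled without side conditions.
data Polynomial : Set where
  con         : ℕ → Polynomial
  var         : Polynomial
  _⊕_ _⊗_ _⊚_ : Polynomial → Polynomial → Polynomial

⟦_⟧ : Polynomial → ℕ → ℕ
⟦ con c ⟧ n = c
⟦ var ⟧   n = n
⟦ p ⊕ q ⟧ n = ⟦ p ⟧ n + ⟦ q ⟧ n
⟦ p ⊗ q ⟧ n = ⟦ p ⟧ n * ⟦ q ⟧ n
⟦ p ⊚ q ⟧ n = ⟦ p ⟧ (⟦ q ⟧ n)

⟦⟧-mono : ∀ p {m n} → m ≤ n → ⟦ p ⟧ m ≤ ⟦ p ⟧ n
⟦⟧-mono (con c) m≤n = ≤-refl
⟦⟧-mono var     m≤n = m≤n
⟦⟧-mono (p ⊕ q) m≤n = +-mono-≤ (⟦⟧-mono p m≤n) (⟦⟧-mono q m≤n)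
⟦⟧-mono (p ⊗ q) m≤n = *-mono-≤ (⟦⟧-mono p m≤n) (⟦⟧-mono q m≤n)
⟦⟧-mono (p ⊚ q) m≤n = ⟦⟧-mono p (⟦⟧-mono q m≤n)

power : ℕ → Polynomial → Polynomial
power zero    p = con 1
power (suc d) p = p ⊗ power d p

⟦power⟧ : ∀ d p n → ⟦ power d p ⟧ n ≡ ⟦ p ⟧ n ^ d
⟦power⟧ zero    p n = refl
⟦power⟧ (suc d) p n = cong (⟦ p ⟧ n *_) (⟦power⟧ d p n)

^-distribʳ-* : ∀ d m n → (m * n) ^ d ≡ m ^ d * n ^ d
^-distribʳ-* zero    m n = refl
^-distribʳ-* (suc d) m n =
  trans (cong (m * n *_) (^-distribʳ-* d m n)) ([m*n]*[o*p]≡[m*o]*[n*p] m n (m ^ d) (n ^ d))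

PolynomiallyBounded : (ℕ → ℕ) → Set
PolynomiallyBounded g = ∃[ C ] ∃[ d ] ∀ n → g n ≤ C * suc n ^ d

bounded-+ : ∀ {g h} → PolynomiallyBounded g → PolynomiallyBounded h →
            PolynomiallyBounded (λ n → g n + h n)
bounded-+ {g} {h} (C , d , g≤) (D , e , h≤) = C + D , d + e , λ n → begin
  g n + h n                                ≤⟨ +-mono-≤ (g≤ n) (h≤ n) ⟩
  C * suc n ^ d + D * suc n ^ e
    ≤⟨ +-mono-≤ (*-monoʳ-≤ C (^-monoʳ-≤ (suc n) (m≤m+n d e)))
                (*-monoʳ-≤ D (^-monoʳ-≤ (suc n) (m≤n+m e d))) ⟩
  C * suc n ^ (d + e) + D * suc n ^ (d + e) ≡⟨ *-distribʳ-+ _ C D ⟨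
  (C + D) * suc n ^ (d + e)                ∎
  where open ≤-Reasoning

bounded-* : ∀ {g h} → PolynomiallyBounded g → PolynomiallyBounded h →
            PolynomiallyBounded (λ n → g n * h n)
bounded-* {g} {h} (C , d , g≤) (D , e , h≤) = C * D , d + e , λ n → begin
  g n * h n                         ≤⟨ *-mono-≤ (g≤ n) (h≤ n) ⟩
  C * suc n ^ d * (D * suc n ^ e)   ≡⟨ [m*n]*[o*p]≡[m*o]*[n*p] C _ D _ ⟩
  C * D * (suc n ^ d * suc n ^ e)   ≡⟨ cong (C * D *_) (^-distribˡ-+-* (suc n) d e) ⟨
  C * D * suc n ^ (d + e)           ∎
  where open ≤-Reasoning

bounded-∘ : ∀ {g h} → PolynomiallyBounded g → PolynomiallyBounded h →
            PolynomiallyBounded (λ n → g (h n))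
bounded-∘ {g} {h} (C , d , g≤) (D , e , h≤) = C * suc D ^ d , e * d , λ n → begin
  g (h n)                                 ≤⟨ g≤ (h n) ⟩
  C * suc (h n) ^ d                       ≤⟨ *-monoʳ-≤ C (^-monoˡ-≤ d (s≤s (h≤ n))) ⟩
  C * suc (D * suc n ^ e) ^ d
    -- The successor is absorbed because `suc n ^ e` is at least 1.
    ≤⟨ *-monoʳ-≤ C (^-monoˡ-≤ d (+-monoˡ-≤ _ (m^n>0 (suc n) e))) ⟩
  C * (suc D * suc n ^ e) ^ d             ≡⟨ cong (C *_) (^-distribʳ-* d (suc D) (suc n ^ e)) ⟩
  C * (suc D ^ d * (suc n ^ e) ^ d)       ≡⟨ *-assoc C _ _ ⟨
  C * suc D ^ d * (suc n ^ e) ^ d         ≡⟨ cong (C * suc D ^ d *_) (^-*-assoc (suc n) e d) ⟩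
  C * suc D ^ d * suc n ^ (e * d)         ∎
  where open ≤-Reasoning

⟦⟧-bounded : ∀ p → PolynomiallyBounded ⟦ p ⟧
⟦⟧-bounded (con c) = c , 0 , λ n → ≤-reflexive (sym (*-identityʳ c))
⟦⟧-bounded var     = 1 , 1 , λ n →
  ≤-trans (n≤1+n n) (≤-reflexive (sym (trans (*-identityˡ _) (*-identityʳ (suc n)))))
⟦⟧-bounded (p ⊕ q) = bounded-+ (⟦⟧-bounded p) (⟦⟧-bounded q)
⟦⟧-bounded (p ⊗ q) = bounded-* (⟦⟧-bounded p) (⟦⟧-bounded q)
⟦⟧-bounded (p ⊚ q) = bounded-∘ {⟦ p ⟧} (⟦⟧-bounded p) (⟦⟧-bounded q)

-- Polynomial-time maps

size : Tree → ℕ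
size nil     = 1
size (x ∙ y) = suc (size x + size y)

size-left : ∀ x → size (left x) ≤ size x
size-left nil     = ≤-refl
size-left (x ∙ y) = m≤n⇒m≤1+n (m≤m+n _ _)

size-right : ∀ x → size (right x) ≤ size x
size-right nil     = ≤-refl
size-right (x ∙ y) = m≤n⇒m≤1+n (m≤n+m _ _)

size≥1 : ∀ x → 1 ≤ size x
size≥1 nil     = ≤-refl
size≥1 (x ∙ y) = s≤s z≤n

infix 3 _⟿_

-- x ⟿ y: one polynomial-time program maps x i to y i for all i.  The
-- index set carries the preconditions and whatever x i does not show.
record _⟿_ {I : Set} (x y : I → Tree) : Set where
  field
    program   : Program
    time      : Polynomial
    outsize   : Polynomial
    run       : ∀ i → ∃[ t ] (program ⊢ x i ⇓[ t ] y i × t ≤ ⟦ time ⟧ (size (x i)))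
    outsize-≤ : ∀ i → size (y i) ≤ ⟦ outsize ⟧ (size (x i))

open _⟿_ public

module _ {I : Set} where

  ⟿-id : {x : I → Tree} → x ⟿ x
  ⟿-id = record
    { program = skip ; time = con 1 ; outsize = var
    ; run = λ i → 1 , skip , ≤-refl ; outsize-≤ = λ i → ≤-refl }

  ⟿-left : {x : I → Tree} → x ⟿ left ∘ x
  ⟿-left {x} = record
    { program = hd ; time = con 1 ; outsize = var
    ; run = λ i → 1 , hd , ≤-refl ; outsize-≤ = λ i → size-left (x i) }

  ⟿-right : {x : I → Tree} → x ⟿ right ∘ x
  ⟿-right {x} = record
    { program = tl ; time = con 1 ; outsize = var
    ; run = λ i → 1 , tl , ≤-refl ; outsize-≤ = λ i → size-right (x i) }

  ⟿-nil : {x : I → Tree} → x ⟿ (λ _ → nil)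
  ⟿-nil = record
    { program = nil ; time = con 1 ; outsize = con 1
    ; run = λ i → 1 , nil , ≤-refl ; outsize-≤ = λ i → ≤-refl }

  infixr 6 _⟿-∙_
  _⟿-∙_ : {x y z : I → Tree} → x ⟿ y → x ⟿ z → x ⟿ (λ i → y i ∙ z i)
  f ⟿-∙ g = record
    { program   = cons (program f) (program g)
    ; time      = con 1 ⊕ time f ⊕ time g
    ; outsize   = con 1 ⊕ outsize f ⊕ outsize g
    ; run       = λ i → let s , f↓ , s≤ = run f i ; t , g↓ , t≤ = run g i in
                  _ , cons f↓ g↓ , s≤s (+-mono-≤ s≤ t≤)
    ; outsize-≤ = λ i → s≤s (+-mono-≤ (outsize-≤ f i) (outsize-≤ g i)) }

  infixr 5 _⟿-⨾_
  -- The second program runs on the intermediate tree, so its time has to be composed with a bound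
  -- on the size of that tree; this is why `_⟿_` carries `outsize`.
  _⟿-⨾_ : {x y z : I → Tree} → x ⟿ y → y ⟿ z → x ⟿ z
  f ⟿-⨾ g = record
    { program   = program f ⨾ program g
    ; time      = con 1 ⊕ time f ⊕ time g ⊚ outsize f
    ; outsize   = outsize g ⊚ outsize f
    ; run       = λ i → let s , f↓ , s≤ = run f i ; t , g↓ , t≤ = run g i in
                  _ , seq f↓ g↓ ,
                  s≤s (+-mono-≤ s≤ (≤-trans t≤ (⟦⟧-mono (time g) (outsize-≤ f i))))
    ; outsize-≤ = λ i → ≤-trans (outsize-≤ g i) (⟦⟧-mono (outsize g) (outsize-≤ f i)) }

  ⟿-resp : {x y z : I → Tree} → (∀ i → y i ≡ z i) → x ⟿ y → x ⟿ z
  ⟿-resp {x} eq f = record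
    { program = program f ; time = time f ; outsize = outsize f
    ; run       = λ i → let t , f↓ , t≤ = run f i in
                  t , subst (program f ⊢ x i ⇓[ t ]_) (eq i) f↓ , t≤
    ; outsize-≤ = λ i → subst (λ y → size y ≤ _) (eq i) (outsize-≤ f i) }

⟿-reindex : {I J : Set} {x y : I → Tree} (ι : J → I) → x ⟿ y → x ∘ ι ⟿ y ∘ ι
⟿-reindex ι f = record
  { program = program f ; time = time f ; outsize = outsize f
  ; run = run f ∘ ι ; outsize-≤ = outsize-≤ f ∘ ι }

cond : Tree → Tree → Tree → Tree
cond nil     y z = z
cond (_ ∙ _) y z = y

-- Which branch runs depends on the index; adding the two bounds replaces taking their maximum.
⟿-cond : {I : Set} {x b y z : I → Tree} → x ⟿ b → x ⟿ y → x ⟿ z →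
         x ⟿ (λ i → cond (b i) (y i) (z i))
⟿-cond {I} {x} {b} {y} {z} f g h = record
  { program   = if program f then program g else program h
  ; time      = con 1 ⊕ time f ⊕ (time g ⊕ time h)
  ; outsize   = outsize g ⊕ outsize h
  ; run       = run′
  ; outsize-≤ = outsize′ }
  where
  run′ : ∀ i → ∃[ t ] (if program f then program g else program h ⊢ x i ⇓[ t ] cond (b i) (y i) (z i)
                      × t ≤ _)
  run′ i with b i | run f i
  ... | nil   | s , f↓ , s≤ = let t , h↓ , t≤ = run h i in
    _ , if-false f↓ h↓ , s≤s (+-mono-≤ s≤ (≤-trans t≤ (m≤n+m _ _)))
  ... | _ ∙ _ | s , f↓ , s≤ = let t , g↓ , t≤ = run g i in
    _ , if-true f↓ g↓ , s≤s (+-mono-≤ s≤ (≤-trans t≤ (m≤m+n _ _)))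
  outsize′ : ∀ i → size (cond (b i) (y i) (z i)) ≤ _
  outsize′ i with b i
  ... | nil   = ≤-trans (outsize-≤ h i) (m≤n+m _ _)
  ... | _ ∙ _ = ≤-trans (outsize-≤ g i) (m≤m+n _ _)

size-Bool : ∀ b → size (encodeBool b) ≤ 3
size-Bool false = s≤s z≤n
size-Bool true  = ≤-refl

module _ {I : Set} {x : I → Tree} where

  ⟿-true : x ⟿ (λ _ → encodeBool true)
  ⟿-true = ⟿-nil ⟿-∙ ⟿-nil

  ⟿-not : {b : I → Bool} → x ⟿ encodeBool ∘ b → x ⟿ (λ i → encodeBool (not (b i)))
  ⟿-not {b} f = ⟿-resp (λ i → cond-not (b i)) (⟿-cond f ⟿-nil ⟿-true)
    where
    cond-not : ∀ b → cond (encodeBool b) nil (nil ∙ nil) ≡ encodeBool (not b)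
    cond-not false = refl
    cond-not true  = refl

  infixr 6 _⟿-∧_
  infixr 5 _⟿-∨_

  _⟿-∧_ : {b c : I → Bool} → x ⟿ encodeBool ∘ b → x ⟿ encodeBool ∘ c →
          x ⟿ (λ i → encodeBool (b i ∧ c i))
  _⟿-∧_ {b} {c} f g = ⟿-resp (λ i → cond-∧ (b i) (c i)) (⟿-cond f g ⟿-nil)
    where
    cond-∧ : ∀ b c → cond (encodeBool b) (encodeBool c) nil ≡ encodeBool (b ∧ c)
    cond-∧ false c = refl
    cond-∧ true  c = refl

  _⟿-∨_ : {b c : I → Bool} → x ⟿ encodeBool ∘ b → x ⟿ encodeBool ∘ c →
          x ⟿ (λ i → encodeBool (b i ∨ c i))
  _⟿-∨_ {b} {c} f g = ⟿-resp (λ i → cond-∨ (b i) (c i)) (⟿-cond f ⟿-true g)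
    where
    cond-∨ : ∀ b c → cond (encodeBool b) (nil ∙ nil) (encodeBool c) ≡ encodeBool (b ∨ c)
    cond-∨ false c = refl
    cond-∨ true  c = refl

-- Loops

-- Leaving out the final failing test makes runs composable: consecutive stretches of one loop can
-- be proved separately and joined by `Passes-trans`.
data Passes (B P : Program) (W : ℕ) : ℕ → Tree → Tree → Set where
  done : ∀ {x} → Passes B P W 0 x x
  pass : ∀ {x b b′ y z m s t} → B ⊢ x ⇓[ s ] b ∙ b′ → P ⊢ x ⇓[ t ] y → s + t ≤ W →
         Passes B P W m y z → Passes B P W (suc m) x z

Passes-trans : ∀ {B P W m n x y z} →
               Passes B P W m x y → Passes B P W n y z → Passes B P W (m + n) x z
Passes-trans done              q = q
Passes-trans (pass B↓ P↓ c≤ p) q = pass B↓ P↓ c≤ (Passes-trans p q)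

Passes⇒while : ∀ {B P W m x y s} → Passes B P W m x y → B ⊢ y ⇓[ s ] nil →
               ∃[ t ] (while B loop P ⊢ x ⇓[ t ] y × t ≤ m * suc W + suc s)
Passes⇒while done stop = _ , while-false stop , ≤-refl
Passes⇒while {W = W} (pass B↓ P↓ c≤ p) stop with Passes⇒while p stop
... | u , p↓ , u≤ = _ , while-true B↓ P↓ p↓ ,
  s≤s (≤-trans (+-mono-≤ c≤ u≤) (≤-reflexive (sym (+-assoc W _ _))))

encodeList : {A : Set} → (A → Tree) → List A → Tree
encodeList e []       = nil
encodeList e (x ∷ xs) = e x ∙ encodeList e xs

length≤size : {A : Set} (e : A → Tree) (xs : List A) → length xs ≤ size (encodeList e xs)
length≤size e []       = z≤n
length≤size e (x ∷ xs) = s≤s (m≤n⇒m≤o+n (size (e x)) (length≤size e xs))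

module _ {I : Set} {x : I → Tree} {A S : I → Set}
         {eA : ∀ {i} → A i → Tree} {eS : ∀ {i} → S i → Tree}
         {l : ∀ i → List (A i)} {s₀ : ∀ i → S i} {step : ∀ i → S i → A i → S i}
         where

  -- A step of polynomial output size may still double its accumulator in each pass, so a bound on
  -- the step alone does not control the loop. The last hypothesis therefore bounds the accumulator
  -- itself, and only at the values that occur, after a prefix of the list.
  ⟿-foldl-bounded :
    x ⟿ (λ i → encodeList eA (l i)) → x ⟿ (λ i → eS (s₀ i)) →
    _⟿_ {Σ I λ i → A i × S i}
      (λ (i , a , s) → x i ∙ (eA a ∙ eS s)) (λ (i , a , s) → eS (step i s a)) →
    (q : Polynomial) →
    (∀ i us vs → l i ≡ us ++ vs → size (eS (foldl (step i) (s₀ i) us)) ≤ ⟦ q ⟧ (size (x i))) →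
    x ⟿ (λ i → eS (foldl (step i) (s₀ i) (l i)))
  ⟿-foldl-bounded f g h q small = record
    { program   = cons skip (cons (program f) (program g)) ⨾ (while test loop body) ⨾ tl ⨾ tl
    ; time      = (con 4 ⊕ (time f ⊕ time g)) ⊕ (con 1 ⊕ (outsize f ⊗ (con 1 ⊕ W) ⊕ con 4) ⊕ con 3)
    ; outsize   = q
    ; run       = run′
    ; outsize-≤ = λ i → small i (l i) [] (sym (++-identityʳ (l i))) }
    where
    test body : Program
    test = tl ⨾ hd
    body = cons hd (cons (tl ⨾ hd ⨾ tl) (cons hd (cons (tl ⨾ hd ⨾ hd) (tl ⨾ tl)) ⨾ program h))
    W : Polynomial
    -- 23 counts the steps of `test` and of `body` apart from `program h`. The argument of `time h`
    -- bounds the tree that `program h` receives: environment, list entry and accumulator.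
    W = con 23 ⊕ time h ⊚ (con 1 ⊕ var ⊕ (con 1 ⊕ outsize f ⊕ q))
    state : ∀ i → List (A i) → S i → Tree
    state i us s = x i ∙ (encodeList eA us ∙ eS s)
    iterate : ∀ i us s → size (encodeList eA us) ≤ ⟦ outsize f ⟧ (size (x i)) →
           (∀ vs ws → us ≡ vs ++ ws → size (eS (foldl (step i) s vs)) ≤ ⟦ q ⟧ (size (x i))) →
           Passes test body (⟦ W ⟧ (size (x i))) (length us)
                  (state i us s) (state i [] (foldl (step i) s us))
    iterate i []       s us≤ s≤ = done
    iterate i (u ∷ us) s us≤ s≤ with run h (i , u , s)
    ... | t , h↓ , t≤ = pass
      (seq tl hd)
      (cons hd (cons (seq tl (seq hd tl))
        (seq (cons hd (cons (seq tl (seq hd hd)) (seq tl tl))) h↓)))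
      (+-monoʳ-≤ 23 (≤-trans t≤ (⟦⟧-mono (time h) (s≤s (+-monoʳ-≤ (size (x i))
        (s≤s (+-mono-≤ (≤-trans (size-left (encodeList eA (u ∷ us))) us≤) (s≤ [] (u ∷ us) refl))))))))
      (iterate i us (step i s u) (≤-trans (size-right (encodeList eA (u ∷ us))) us≤)
        (λ vs ws eq → s≤ (u ∷ vs) ws (cong (u ∷_) eq)))
    run′ : ∀ i → ∃[ t ] (_ ⊢ x i ⇓[ t ] _ × t ≤ _)
    run′ i with run f i | run g i
    ... | s , f↓ , s≤ | t , g↓ , t≤
      with Passes⇒while (iterate i (l i) (s₀ i) (outsize-≤ f i) (small i)) (seq tl hd)
    ... | u , w↓ , u≤ = _ , seq (cons skip (cons f↓ g↓)) (seq w↓ (seq tl tl)) ,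
      +-mono-≤ (+-monoʳ-≤ 4 (+-mono-≤ s≤ t≤))
        (s≤s (+-monoˡ-≤ 3 (≤-trans u≤ (+-monoˡ-≤ 4
          (*-monoˡ-≤ (suc (⟦ W ⟧ (size (x i)))) (≤-trans (length≤size eA (l i)) (outsize-≤ f i)))))))

size-++ˡ : {A : Set} (e : A → Tree) (us vs : List A) →
           size (encodeList e us) ≤ size (encodeList e (us ++ vs))
size-++ˡ e []       vs = size≥1 _
size-++ˡ e (u ∷ us) vs = s≤s (+-monoʳ-≤ (size (e u)) (size-++ˡ e us vs))

size-++ : {A : Set} (e : A → Tree) (us vs : List A) →
          size (encodeList e (us ++ vs)) ≤ size (encodeList e vs) + size (encodeList e us)
size-++ e []       vs = m≤m+n _ _
size-++ e (u ∷ us) vs = begin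
  suc (size (e u) + size (encodeList e (us ++ vs)))   ≤⟨ s≤s (+-monoʳ-≤ (size (e u)) (size-++ e us vs)) ⟩
  suc (size (e u) + (V + U))                          ≡⟨ cong suc (+-assoc (size (e u)) V U) ⟨
  suc (size (e u) + V + U)                            ≡⟨ cong (λ m → suc (m + U)) (+-comm (size (e u)) V) ⟩
  suc (V + size (e u) + U)                            ≡⟨ cong suc (+-assoc V (size (e u)) U) ⟩
  suc (V + (size (e u) + U))                          ≡⟨ +-suc V _ ⟨
  V + suc (size (e u) + U)                            ∎
  where
  open ≤-Reasoning
  U = size (encodeList e us)
  V = size (encodeList e vs)

module _ {I : Set} {x : I → Tree} {A S : I → Set}
         {eA : ∀ {i} → A i → Tree} {eS : ∀ {i} → S i → Tree}
         where

  -- The growth in one pass is bounded by the environment and the list entry, independently of the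
  -- accumulator, so over the passes it adds up instead of compounding.
  ⟿-foldl :
    {l : ∀ i → List (A i)} {s₀ : ∀ i → S i} {step : ∀ i → S i → A i → S i} →
    x ⟿ (λ i → encodeList eA (l i)) → x ⟿ (λ i → eS (s₀ i)) →
    _⟿_ {Σ I λ i → A i × S i}
      (λ (i , a , s) → x i ∙ (eA a ∙ eS s)) (λ (i , a , s) → eS (step i s a)) →
    (q : Polynomial) →
    (∀ i a s → size (eS (step i s a)) ≤ size (eS s) + ⟦ q ⟧ (size (x i) + size (eA a))) →
    x ⟿ (λ i → eS (foldl (step i) (s₀ i) (l i)))
  ⟿-foldl {l} {s₀} {step} f g h q growth =
    ⟿-foldl-bounded f g h (outsize g ⊕ outsize f ⊗ q ⊚ (var ⊕ outsize f)) λ i us vs eq →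
      let us≤ = ≤-trans (≤-trans (size-++ˡ eA us vs)
                  (≤-reflexive (cong (size ∘ encodeList eA) (sym eq)))) (outsize-≤ f i)
      in ≤-trans (grow i us (s₀ i) us≤)
           (+-mono-≤ (outsize-≤ g i) (*-monoˡ-≤ _ (≤-trans (length≤size eA us) us≤)))
    where
    open ≤-Reasoning
    Q : I → ℕ
    Q i = ⟦ q ⊚ (var ⊕ outsize f) ⟧ (size (x i))
    grow : ∀ i us s → size (encodeList eA us) ≤ ⟦ outsize f ⟧ (size (x i)) →
           size (eS (foldl (step i) s us)) ≤ size (eS s) + length us * Q i
    grow i []       s us≤ = m≤m+n _ _
    grow i (u ∷ us) s us≤ = begin
      size (eS (foldl (step i) (step i s u) us))
        ≤⟨ grow i us (step i s u) (≤-trans (size-right (encodeList eA (u ∷ us))) us≤) ⟩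
      size (eS (step i s u)) + length us * Q i
        ≤⟨ +-monoˡ-≤ _ (growth i u s) ⟩
      size (eS s) + ⟦ q ⟧ (size (x i) + size (eA u)) + length us * Q i
        ≤⟨ +-monoˡ-≤ _ (+-monoʳ-≤ (size (eS s)) (⟦⟧-mono q (+-monoʳ-≤ (size (x i))
             (≤-trans (size-left (encodeList eA (u ∷ us))) us≤)))) ⟩
      size (eS s) + Q i + length us * Q i
        ≡⟨ +-assoc (size (eS s)) _ _ ⟩
      size (eS s) + suc (length us) * Q i ∎

module _ {I : Set} {x : I → Tree} {A : I → Set} {eA : ∀ {i} → A i → Tree} where

  ⟿-reverse : {l : ∀ i → List (A i)} →
    -- In the loop state `x ∙ (a ∙ s)` the right part is already the encoding of `a ∷ s`, so the
    -- step is a mere projection.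
    x ⟿ (λ i → encodeList eA (l i)) → x ⟿ (λ i → encodeList eA (reverse (l i)))
  ⟿-reverse f = ⟿-foldl {eS = encodeList eA} f ⟿-nil ⟿-right var λ i a s →
    begin
      suc (size (eA a) + size (encodeList eA s))  ≡⟨ cong suc (+-comm (size (eA a)) _) ⟩
      suc (size (encodeList eA s) + size (eA a))  ≡⟨ +-suc _ _ ⟨
      size (encodeList eA s) + suc (size (eA a))
        ≤⟨ +-monoʳ-≤ (size (encodeList eA s)) (+-monoˡ-≤ (size (eA a)) (size≥1 (x i))) ⟩
      size (encodeList eA s) + (size (x i) + size (eA a)) ∎
    where open ≤-Reasoning

  -- Environments grow to the right: under a binder, the input x i
  -- becomes x i ∙ eA a.
  ⟿-weaken : {y : I → Tree} → x ⟿ y →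
             _⟿_ {Σ I A} (λ (i , a) → x i ∙ eA a) (λ (i , a) → y i)
  ⟿-weaken f = ⟿-left ⟿-⨾ ⟿-reindex proj₁ f

  ⟿-newest : _⟿_ {Σ I A} (λ (i , a) → x i ∙ eA a) (λ (i , a) → eA a)
  ⟿-newest = ⟿-right

  module _ {l : ∀ i → List (A i)} (f : x ⟿ (λ i → encodeList eA (l i))) where

    -- A loop consumes its list from the front, so a right fold runs over the reversed list; the
    -- state is regrouped into an environment extended by two binders.
    ⟿-foldr :
      {S : I → Set} {eS : ∀ {i} → S i → Tree} {s₀ : ∀ i → S i} {step : ∀ i → A i → S i → S i} →
      x ⟿ (λ i → eS (s₀ i)) →
      _⟿_ {Σ (Σ I A) λ (i , a) → S i}
        (λ ((i , a) , s) → (x i ∙ eA a) ∙ eS s) (λ ((i , a) , s) → eS (step i a s)) →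
      (q : Polynomial) →
      (∀ i a s → size (eS (step i a s)) ≤ size (eS s) + ⟦ q ⟧ (size (x i) + size (eA a))) →
      x ⟿ (λ i → eS (foldr (step i) (s₀ i) (l i)))
    ⟿-foldr {eS = eS} {s₀} {step} g h q growth =
      ⟿-resp (λ i → cong eS (reverse-foldl (flip (step i)) (s₀ i) (l i)))
        (⟿-foldl {eS = eS} (⟿-reverse f) g
          (((⟿-left ⟿-∙ (⟿-right ⟿-⨾ ⟿-left)) ⟿-∙ (⟿-right ⟿-⨾ ⟿-right))
            ⟿-⨾ ⟿-reindex (λ (i , a , s) → (i , a) , s) h)
          q growth)

    private
      ⟿-element : {S : I → Set} {eS : ∀ {i} → S i → Tree} {y : Σ I A → Tree} →
        _⟿_ {Σ I A} (λ (i , a) → x i ∙ eA a) y →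
        _⟿_ {Σ (Σ I A) λ (i , a) → S i} (λ ((i , a) , s) → (x i ∙ eA a) ∙ eS s) (y ∘ proj₁)
      ⟿-element h = ⟿-left ⟿-⨾ ⟿-reindex proj₁ h

    ⟿-any : {p : ∀ i → A i → Bool} →
      _⟿_ {Σ I A} (λ (i , a) → x i ∙ eA a) (λ (i , a) → encodeBool (p i a)) →
      x ⟿ (λ i → encodeBool (any (p i) (l i)))
    ⟿-any {p} h = ⟿-resp (λ i → cong encodeBool (any-foldr (p i) (l i)))
      (⟿-foldr {eS = encodeBool} {step = λ i a b → p i a ∨ b} ⟿-nil (⟿-element h ⟿-∨ ⟿-right)
        (con 3) λ i a b → ≤-trans (size-Bool (p i a ∨ b)) (m≤n+m 3 _))
      where
      any-foldr : ∀ {A : Set} (p : A → Bool) xs → foldr (λ a b → p a ∨ b) false xs ≡ any p xs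
      any-foldr p []       = refl
      any-foldr p (x ∷ xs) = cong (p x ∨_) (any-foldr p xs)

    ⟿-all : {p : ∀ i → A i → Bool} →
      _⟿_ {Σ I A} (λ (i , a) → x i ∙ eA a) (λ (i , a) → encodeBool (p i a)) →
      x ⟿ (λ i → encodeBool (all (p i) (l i)))
    ⟿-all {p} h = ⟿-resp (λ i → cong encodeBool (all-foldr (p i) (l i)))
      (⟿-foldr {eS = encodeBool} {step = λ i a b → p i a ∧ b} ⟿-true (⟿-element h ⟿-∧ ⟿-right)
        (con 3) λ i a b → ≤-trans (size-Bool (p i a ∧ b)) (m≤n+m 3 _))
      where
      all-foldr : ∀ {A : Set} (p : A → Bool) xs → foldr (λ a b → p a ∧ b) true xs ≡ all p xs
      all-foldr p []       = refl
      all-foldr p (x ∷ xs) = cong (p x ∧_) (all-foldr p xs)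

    ⟿-map : {B : I → Set} {eB : ∀ {i} → B i → Tree} {g : ∀ i → A i → B i} →
      _⟿_ {Σ I A} (λ (i , a) → x i ∙ eA a) (λ (i , a) → eB (g i a)) →
      x ⟿ (λ i → encodeList eB (map (g i) (l i)))
    ⟿-map {eB = eB} {g} h = ⟿-resp (λ i → cong (encodeList eB) (sym (map-is-foldr (l i))))
      (⟿-foldr {eS = encodeList eB} {step = λ i a s → g i a ∷ s} ⟿-nil (⟿-element h ⟿-∙ ⟿-right)
        (con 1 ⊕ outsize h ⊚ (con 1 ⊕ var)) λ i a s → begin
          suc (size (eB (g i a)) + size (encodeList eB s))
            ≤⟨ s≤s (+-monoˡ-≤ _ (outsize-≤ h (i , a))) ⟩
          suc (⟦ outsize h ⟧ _ + size (encodeList eB s))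
            ≡⟨ +-comm _ (size (encodeList eB s)) ⟩
          size (encodeList eB s) + suc (⟦ outsize h ⟧ _)    ∎)
      where open ≤-Reasoning

    ⟿-filter : {p : ∀ i → A i → Bool} →
      _⟿_ {Σ I A} (λ (i , a) → x i ∙ eA a) (λ (i , a) → encodeBool (p i a)) →
      x ⟿ (λ i → encodeList eA (filterᵇ (p i) (l i)))
    ⟿-filter {p} h = ⟿-resp (λ i → cong (encodeList eA) (foldr-keep (p i) (l i)))
      (⟿-foldr {eS = encodeList eA} {step = λ i a s → keep (p i a) a s} ⟿-nil
        (⟿-resp (λ ((i , a) , s) → cond-keep (p i a) a s)
          (⟿-cond (⟿-element h) ((⟿-left ⟿-⨾ ⟿-right) ⟿-∙ ⟿-right) ⟿-right))
        var λ i a s → ≤-trans (size-keep (p i a) a s)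
          (+-monoʳ-≤ (size (encodeList eA s)) (+-monoˡ-≤ (size (eA a)) (size≥1 (x i)))))
      where
      keep : ∀ {A : Set} → Bool → A → List A → List A
      keep false a s = s
      keep true  a s = a ∷ s
      foldr-keep : ∀ {A : Set} (p : A → Bool) xs → foldr (λ a s → keep (p a) a s) [] xs ≡ filterᵇ p xs
      foldr-keep p []       = refl
      foldr-keep p (x ∷ xs) with p x
      ... | false = foldr-keep p xs
      ... | true  = cong (x ∷_) (foldr-keep p xs)
      cond-keep : ∀ {i} b (a : A i) s →
        cond (encodeBool b) (eA a ∙ encodeList eA s) (encodeList eA s) ≡ encodeList eA (keep b a s)
      cond-keep false a s = refl
      cond-keep true  a s = refl
      size-keep : ∀ {i} b (a : A i) s →
        size (encodeList eA (keep b a s)) ≤ size (encodeList eA s) + suc (size (eA a))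
      size-keep false a s = m≤m+n _ _
      size-keep true  a s = ≤-reflexive (+-comm (suc (size (eA a))) _)

    infixr 5 _⟿-++_
    _⟿-++_ : {l′ : ∀ i → List (A i)} →
      x ⟿ (λ i → encodeList eA (l′ i)) → x ⟿ (λ i → encodeList eA (l i ++ l′ i))
    _⟿-++_ {l′} g = ⟿-resp (λ i → cong (encodeList eA) (sym (++-is-foldr (l i) (l′ i))))
      (⟿-foldr {eS = encodeList eA} {step = λ i a s → a ∷ s} g ((⟿-left ⟿-⨾ ⟿-right) ⟿-∙ ⟿-right)
        var λ i a s → ≤-trans (≤-reflexive (+-comm (suc (size (eA a))) _))
          (+-monoʳ-≤ (size (encodeList eA s)) (+-monoˡ-≤ (size (eA a)) (size≥1 (x i)))))

⟿-concatMap : {I : Set} {x : I → Tree} {A B : I → Set}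
  {eA : ∀ {i} → A i → Tree} {eB : ∀ {i} → B i → Tree}
  {l : ∀ i → List (A i)} {g : ∀ i → A i → List (B i)} →
  x ⟿ (λ i → encodeList eA (l i)) →
  _⟿_ {Σ I A} (λ (i , a) → x i ∙ eA a) (λ (i , a) → encodeList eB (g i a)) →
  x ⟿ (λ i → encodeList eB (concatMap (g i) (l i)))
⟿-concatMap {A = A} {B} {eA = eA} {eB} {l} {g} f h =
  ⟿-resp (λ i → cong (encodeList eB) (concatMap-foldr (g i) (l i)))
    (⟿-foldr f {S = λ i → List (B i)} {eS = encodeList eB} {step = λ i a s → g i a ++ s} ⟿-nil
      (_⟿-++_ {eA = eB} (⟿-left ⟿-⨾ ⟿-reindex proj₁ h) ⟿-right)
      (outsize h ⊚ (con 1 ⊕ var)) λ i a s → ≤-trans (size-++ eB (g i a) s)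
        (+-monoʳ-≤ (size (encodeList eB s)) (outsize-≤ h (i , a))))
  where
  concatMap-foldr : ∀ {A B : Set} (g : A → List B) xs → foldr (λ a s → g a ++ s) [] xs ≡ concatMap g xs
  concatMap-foldr g []       = refl
  concatMap-foldr g (x ∷ xs) = cong (g x ++_) (concatMap-foldr g xs)

-- Unary numbers, comparison, indexing and counting

encodeℕ : ℕ → Tree
encodeℕ n = encodeList (λ (_ : ⊤) → nil) (replicate n tt)

encodeFin : ∀ {n} → Fin n → Tree
encodeFin i = encodeℕ (toℕ i)

size-encodeℕ : ∀ n → size (encodeℕ n) ≡ 1 + 2 * n
size-encodeℕ zero    = refl
size-encodeℕ (suc n) =
  trans (cong (2 +_) (size-encodeℕ n)) (cong (1 +_) (sym (*-suc 2 n)))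

tail : ℕ → Tree → Tree
tail zero    t = t
tail (suc n) t = tail n (right t)

tail-nil : ∀ n → tail n nil ≡ nil
tail-nil zero    = refl
tail-nil (suc n) = tail-nil n

encodeList-map : ∀ {A B : Set} (e : B → Tree) (f : A → B) xs →
                 encodeList e (map f xs) ≡ encodeList (e ∘ f) xs
encodeList-map e f []       = refl
encodeList-map e f (x ∷ xs) = cong (e (f x) ∙_) (encodeList-map e f xs)

encodeVec-toList : ∀ {A : Set} {n} (e : A → Tree) (xs : Vec A n) →
                   encodeVec e xs ≡ encodeList e (toList xs)
encodeVec-toList e []       = refl
encodeVec-toList e (x ∷ xs) = cong (e x ∙_) (encodeVec-toList e xs)

encodeVec-tabulate : ∀ {A : Set} {n} (e : A → Tree) (f : Fin n → A) →
                     encodeVec e (tabulate f) ≡ encodeList e (map f (allFin n))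
encodeVec-tabulate e f = trans (tabulate-List f) (cong (encodeList e) (sym (map-tabulate id f)))
  where
  tabulate-List : ∀ {n} (f : Fin n → _) → encodeVec e (tabulate f) ≡ encodeList e (List.tabulate f)
  tabulate-List {zero}  f = refl
  tabulate-List {suc n} f = cong (e (f zero) ∙_) (tabulate-List (f ∘ suc))

module _ {I : Set} {x : I → Tree} where

  ⟿-tail : {m : I → ℕ} {y : I → Tree} → x ⟿ encodeℕ ∘ m → x ⟿ y → x ⟿ (λ i → tail (m i) (y i))
  ⟿-tail {m} {y} f g = ⟿-resp (λ i → foldl-tail (m i) (y i))
    (⟿-foldl {eA = λ _ → nil} {eS = id} {step = λ i t _ → right t} f g
      (⟿-right ⟿-⨾ ⟿-right ⟿-⨾ ⟿-right) (con 0)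
      λ i a t → ≤-trans (size-right t) (m≤m+n _ 0))
    where
    foldl-tail : ∀ n t → foldl (λ t _ → right t) t (replicate n tt) ≡ tail n t
    foldl-tail zero    t = refl
    foldl-tail (suc n) t = foldl-tail n (right t)

  ⟿-null : {y : I → Tree} → x ⟿ y → x ⟿ (λ i → cond (y i) nil (nil ∙ nil))
  ⟿-null f = ⟿-cond f ⟿-nil (⟿-nil ⟿-∙ ⟿-nil)

  -- Since `tail` stays at `nil`, it computes truncated subtraction of unary numbers; two numbers
  -- agree when both differences vanish.
  ⟿-≡ᵇ : {m n : I → ℕ} → x ⟿ encodeℕ ∘ m → x ⟿ encodeℕ ∘ n →
          x ⟿ (λ i → encodeBool (m i ≡ᵇ n i))
  ⟿-≡ᵇ {m} {n} f g = ⟿-resp (λ i → tails (m i) (n i))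
    (⟿-cond (⟿-null (⟿-tail f g)) (⟿-null (⟿-tail g f)) ⟿-nil)
    where
    tails : ∀ m n → cond (cond (tail m (encodeℕ n)) nil (nil ∙ nil))
                         (cond (tail n (encodeℕ m)) nil (nil ∙ nil)) nil ≡ encodeBool (m ≡ᵇ n)
    tails zero    zero    = refl
    tails zero    (suc n) = refl
    tails (suc m) zero    rewrite tail-nil m = refl
    tails (suc m) (suc n) = tails m n

  ⟿-lookup : {n : I → ℕ} {A : I → Set} {eA : ∀ {i} → A i → Tree}
    {xs : ∀ i → Vec (A i) (n i)} {j : ∀ i → Fin (n i)} →
    x ⟿ (λ i → encodeVec eA (xs i)) → x ⟿ (λ i → encodeFin (j i)) →
    x ⟿ (λ i → eA (lookup (xs i) (j i)))
  ⟿-lookup {eA = eA} {xs} {j} f g = ⟿-resp (λ i → left-tail eA (xs i) (j i)) (⟿-tail g f ⟿-⨾ ⟿-left)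
    where
    left-tail : ∀ {n} {A : Set} (e : A → Tree) (xs : Vec A n) j →
                left (tail (toℕ j) (encodeVec e xs)) ≡ e (lookup xs j)
    left-tail e (x ∷ xs) zero    = refl
    left-tail e (x ∷ xs) (suc j) = left-tail e xs j

  -- The number added in a pass exceeds the head of the accumulator by one, so the growth depends on
  -- the accumulator and `⟿-foldl` does not apply. The exact value of each intermediate accumulator
  -- gives the bound instead.
  ⟿-downFrom : {A : I → Set} {eA : ∀ {i} → A i → Tree} {l : ∀ i → List (A i)} →
    x ⟿ (λ i → encodeList eA (l i)) → x ⟿ (λ i → encodeList encodeℕ (downFrom (length (l i))))
  ⟿-downFrom {A} {eA} {l} f =
    ⟿-resp (λ i → cong (encodeList encodeℕ) (foldl-count (l i)))
      (⟿-foldl-bounded {eA = eA} {eS = encodeList encodeℕ} {step = λ i s _ → next s ∷ s} f ⟿-nil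
        (⟿-resp (λ (i , a , s) → cong (_∙ encodeList encodeℕ s) (cond-next s))
          (⟿-cond s (⟿-nil ⟿-∙ (s ⟿-⨾ ⟿-left)) ⟿-nil ⟿-∙ s))
        (con 1 ⊕ outsize f ⊗ (con 2 ⊗ (con 1 ⊕ outsize f)))
        λ i us vs eq → let us≤ = small i us vs eq in
          ≤-trans (≤-reflexive (cong (size ∘ encodeList encodeℕ) (foldl-count us)))
            (≤-trans (size-downFrom us≤) (s≤s (*-monoˡ-≤ _ us≤))))
    where
    open ≤-Reasoning
    s = ⟿-right ⟿-⨾ ⟿-right
    next : List ℕ → ℕ
    next []      = zero
    next (k ∷ _) = suc k
    cond-next : ∀ s → cond (encodeList encodeℕ s) (nil ∙ left (encodeList encodeℕ s)) nil ≡ encodeℕ (next s)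
    cond-next []      = refl
    cond-next (k ∷ s) = refl
    next-downFrom : ∀ k → next (downFrom k) ≡ k
    next-downFrom zero    = refl
    next-downFrom (suc k) = refl
    count : ∀ {A : Set} k (us : List A) → foldl (λ s _ → next s ∷ s) (downFrom k) us ≡ downFrom (length us + k)
    count k []       = refl
    count k (u ∷ us) rewrite next-downFrom k = trans (count (suc k) us) (cong downFrom (+-suc (length us) k))
    foldl-count : ∀ {A : Set} (us : List A) → foldl (λ s _ → next s ∷ s) [] us ≡ downFrom (length us)
    foldl-count us = trans (count 0 us) (cong downFrom (+-identityʳ (length us)))
    small : ∀ i us vs → l i ≡ us List.++ vs → length us ≤ ⟦ outsize f ⟧ (size (x i))
    small i us vs eq = ≤-trans (length-++-≤ˡ us)
      (≤-trans (≤-reflexive (cong length (sym eq))) (≤-trans (length≤size eA (l i)) (outsize-≤ f i)))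
    size-downFrom : ∀ {k K} → k ≤ K → size (encodeList encodeℕ (downFrom k)) ≤ 1 + k * (2 * suc K)
    size-downFrom {zero}      k≤K = ≤-refl
    size-downFrom {suc k} {K} k≤K = s≤s (begin
      size (encodeℕ k) + size (encodeList encodeℕ (downFrom k))
        ≤⟨ +-mono-≤ (≤-reflexive (size-encodeℕ k)) (size-downFrom (<⇒≤ k≤K)) ⟩
      1 + 2 * k + (1 + k * (2 * suc K))  ≡⟨ cong suc (+-suc (2 * k) _) ⟩
      2 + 2 * k + k * (2 * suc K)        ≡⟨ cong (_+ k * (2 * suc K)) (*-suc 2 k) ⟨
      2 * suc k + k * (2 * suc K)        ≤⟨ +-monoˡ-≤ _ (*-monoʳ-≤ 2 (m≤n⇒m≤1+n k≤K)) ⟩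
      2 * suc K + k * (2 * suc K)        ∎)

  -- The vector acts as a unary counter for `n`; for a graph, the rows of the adjacency matrix
  -- serve. Counting yields the numbers in descending order, hence the reversal.
  ⟿-allFin : {A : I → Set} {eA : ∀ {i} → A i → Tree} {n : I → ℕ} {xs : ∀ i → Vec (A i) (n i)} →
    x ⟿ (λ i → encodeVec eA (xs i)) → x ⟿ (λ i → encodeList encodeFin (allFin (n i)))
  ⟿-allFin {eA = eA} {n} {xs} f = ⟿-resp eq
    (⟿-reverse {eA = encodeℕ} (⟿-downFrom {eA = eA} (⟿-resp (λ i → encodeVec-toList eA (xs i)) f)))
    where
    tabulate-applyUpTo : ∀ {n} (f : ℕ → ℕ) → List.tabulate {n = n} (f ∘ toℕ) ≡ applyUpTo f n
    tabulate-applyUpTo {zero}  f = refl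
    tabulate-applyUpTo {suc n} f = cong (f 0 ∷_) (tabulate-applyUpTo (f ∘ suc))
    eq : ∀ i → encodeList encodeℕ (reverse (downFrom (length (toList (xs i))))) ≡
               encodeList encodeFin (allFin (n i))
    eq i rewrite length-toList (xs i) = trans
      (cong (encodeList encodeℕ) (trans (reverse-downFrom (n i))
        (sym (trans (map-tabulate id toℕ) (tabulate-applyUpTo id)))))
      (encodeList-map encodeℕ toℕ (allFin (n i)))

-- Reflection of Boolean quantifiers

∧-intro : ∀ a {b} → T a → T b → T (a ∧ b)
∧-intro true _ t = t

∧-elim : ∀ a {b} → T (a ∧ b) → T a × T b
∧-elim true t = tt , t

∨-elim : ∀ a {b} → T (a ∨ b) → T a ⊎ T b
∨-elim true  t = inj₁ tt
∨-elim false t = inj₂ t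

∨-introʳ : ∀ a {b} → T b → T (a ∨ b)
∨-introʳ true  t = tt
∨-introʳ false t = t

⇒-intro : ∀ a {b} → (T a → T b) → T (not a ∨ b)
⇒-intro true  f = f tt
⇒-intro false f = tt

⇒-elim : ∀ a {b} → T (not a ∨ b) → T a → T b
⇒-elim true t _ = t

not-intro : ∀ {b} → ¬ T b → T (not b)
not-intro {true}  f = f tt
not-intro {false} f = tt

not-elim : ∀ {b} → T (not b) → ¬ T b
not-elim {true} ()

module _ {A : Set} (p : A → Bool) where

  any-intro : ∀ {x xs} → x ∈ˡ xs → T (p x) → T (any p xs)
  any-intro x∈ px = any⁺ p (lose x∈ px)

  any-elim : ∀ xs → T (any p xs) → ∃[ x ] (x ∈ˡ xs × T (p x))
  any-elim xs t = find (any⁻ p xs t)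

  all-intro : ∀ xs → (∀ {x} → x ∈ˡ xs → T (p x)) → T (all p xs)
  all-intro xs f = all⁻ p (All.tabulate {xs = xs} f)

  all-elim : ∀ {x xs} → T (all p xs) → x ∈ˡ xs → T (p x)
  all-elim t = All.lookup (all⁺ p _ t)

  filterᵇ-intro : ∀ {x xs} → x ∈ˡ xs → T (p x) → x ∈ˡ filterᵇ p xs
  filterᵇ-intro = ∈-filter⁺ (T? ∘ p)

  filterᵇ-elim : ∀ {x} xs → x ∈ˡ filterᵇ p xs → x ∈ˡ xs × T (p x)
  filterᵇ-elim xs = ∈-filter⁻ (T? ∘ p) {xs = xs}

-- Colourings

data Colour : Set where
  cut side₁ side₂ : Colour

colours : List Colour
colours = side₁ ∷ side₂ ∷ cut ∷ []

∈-colours : ∀ z → z ∈ˡ colours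
∈-colours side₁ = here refl
∈-colours side₂ = there (here refl)
∈-colours cut   = there (there (here refl))

_≟ᶜ_ : DecidableEquality Colour
cut   ≟ᶜ cut   = yes refl
cut   ≟ᶜ side₁ = no λ ()
cut   ≟ᶜ side₂ = no λ ()
side₁ ≟ᶜ cut   = no λ ()
side₁ ≟ᶜ side₁ = yes refl
side₁ ≟ᶜ side₂ = no λ ()
side₂ ≟ᶜ cut   = no λ ()
side₂ ≟ᶜ side₁ = no λ ()
side₂ ≟ᶜ side₂ = yes refl

same : Colour → Colour → Bool
same cut   cut   = true
same side₁ side₁ = true
same side₂ side₂ = true
same _     _     = false

same⇒≡ : ∀ w z → T (same w z) → w ≡ z
same⇒≡ cut   cut   _ = refl
same⇒≡ side₁ side₁ _ = refl
same⇒≡ side₂ side₂ _ = refl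

≡⇒same : ∀ w {z} → w ≡ z → T (same w z)
≡⇒same cut   refl = tt
≡⇒same side₁ refl = tt
≡⇒same side₂ refl = tt

-- The adjacency of the path side₁, cut, side₂ with a loop at each end; proper colourings are the
-- homomorphisms into this graph.
touch : Colour → Colour → Bool
touch cut   cut   = false
touch side₁ side₂ = false
touch side₂ side₁ = false
touch _     _     = true

isCut : Colour → Bool
isCut cut = true
isCut _   = false

isCut⇒≡ : ∀ z → T (isCut z) → z ≡ cut
isCut⇒≡ cut _ = refl

-- The complement of `touch` is the graph of this permutation, so a coloured neighbour rules out
-- exactly one colour.
clash : Colour → Colour
clash cut   = cut
clash side₁ = side₂
clash side₂ = side₁

¬touch-clash : ∀ z → ¬ T (touch z (clash z))
¬touch-clash cut   ()
¬touch-clash side₁ ()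
¬touch-clash side₂ ()

another : ∀ (z : Colour) → ∃[ w ] w ≢ z
another cut   = side₁ , λ ()
another side₁ = cut , λ ()
another side₂ = cut , λ ()

touch-side : ∀ {w z} → z ≢ cut → T (touch w z) → w ≢ cut → w ≡ z
touch-side {cut}   {_}     z≢ t w≢ = ⊥-elim (w≢ refl)
touch-side {_}     {cut}   z≢ t w≢ = ⊥-elim (z≢ refl)
touch-side {side₁} {side₁} z≢ t w≢ = refl
touch-side {side₂} {side₂} z≢ t w≢ = refl

remaining : ∀ (z₀ : Colour) → ∃[ z₁ ] ∃[ z₂ ] (∀ z → z ≢ z₀ → z ≡ z₁ ⊎ z ≡ z₂)
remaining cut   = side₁ , side₂ , λ { cut   z≢ → ⊥-elim (z≢ refl) ; side₁ _ → inj₁ refl ; side₂ _ → inj₂ refl }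
remaining side₁ = cut , side₂ , λ { side₁ z≢ → ⊥-elim (z≢ refl) ; cut _ → inj₁ refl ; side₂ _ → inj₂ refl }
remaining side₂ = cut , side₁ , λ { side₂ z≢ → ⊥-elim (z≢ refl) ; cut _ → inj₁ refl ; side₁ _ → inj₂ refl }

-- Binary constraints on colours and elimination of vertices

Literal : Graph → Set
Literal G = Vertex G × Colour

ProperColouring : (G : Graph) → (Vertex G → Colour) → Set
ProperColouring G φ = ∀ u v → Adjacent G u v → T (touch (φ u) (φ v))

module _ (G : Graph) where

  sameVertex : Vertex G → Vertex G → Bool
  sameVertex u v = toℕ u ≡ᵇ toℕ v

  sameVertex⇒≡ : ∀ u v → T (sameVertex u v) → u ≡ v
  sameVertex⇒≡ u v t = toℕ-injective (≡ᵇ⇒≡ _ _ t)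

  ≡⇒sameVertex : ∀ u {v} → u ≡ v → T (sameVertex u v)
  ≡⇒sameVertex u refl = ≡⇒≡ᵇ (toℕ u) _ refl

  sameLiteral : Literal G → Literal G → Bool
  sameLiteral (u , w) (v , z) = sameVertex u v ∧ same w z

  sameLiteral⇒≡ : ∀ p q → T (sameLiteral p q) → p ≡ q
  sameLiteral⇒≡ (u , w) (v , z) t =
    let u≡v , w≡z = ∧-elim (sameVertex u v) t in cong₂ _,_ (sameVertex⇒≡ u v u≡v) (same⇒≡ w z w≡z)

  sameLiteral-refl : ∀ p → T (sameLiteral p p)
  sameLiteral-refl (u , w) = ∧-intro (sameVertex u u) (≡⇒sameVertex u refl) (≡⇒same w refl)

  -- The first conjunct lets the same relation express that a vertex has only one colour, so pins
  -- need no separate treatment.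
  compatible : Literal G → Literal G → Bool
  compatible (u , w) (v , z) = (not (sameVertex u v) ∨ same w z) ∧ (not (adj G u v) ∨ touch w z)

  compatible-≡ : ∀ v w z → T (compatible (v , w) (v , z)) → w ≡ z
  compatible-≡ v w z t = same⇒≡ w z
    (⇒-elim (sameVertex v v) (proj₁ (∧-elim (not (sameVertex v v) ∨ same w z) t)) (≡⇒sameVertex v refl))

  compatible-touch : ∀ u v w z → T (compatible (u , w) (v , z)) → Adjacent G u v → T (touch w z)
  compatible-touch u v w z t =
    ⇒-elim (adj G u v) (proj₂ (∧-elim (not (sameVertex u v) ∨ same w z) t))

  proper⇒compatible : ∀ {φ} → ProperColouring G φ → ∀ u v → T (compatible (u , φ u) (v , φ v))
  proper⇒compatible {φ} proper u v = ∧-intro (not (sameVertex u v) ∨ same (φ u) (φ v))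
    (⇒-intro (sameVertex u v) λ u≡v → ≡⇒same (φ u) (cong φ (sameVertex⇒≡ u v u≡v)))
    (⇒-intro (adj G u v) (proper u v))

  -- Constraints are the list of the permitted pairs, so eliminating a
  -- variable only deletes entries and the representation never grows.
  Constraints : Set
  Constraints = List (Literal G × Literal G)

  permits : Constraints → Literal G → Literal G → Bool
  permits M p q = any (λ (p′ , q′) → sameLiteral p p′ ∧ sameLiteral q q′) M

  -- The pair `(r , r)` expresses that `r` itself is allowed. Both orders of the other pair are
  -- tested because `M` is not assumed symmetric.
  supports : Constraints → Literal G → Literal G → Bool
  supports M r p = permits M r r ∧ permits M p r ∧ permits M r p

  -- This is resolution on `v`: a pair remains if a single colour of `v` is consistent with both of
  -- its literals.
  survives : Constraints → Vertex G → Literal G × Literal G → Bool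
  survives M v (p , q) = any (λ z → supports M (v , z) p ∧ supports M (v , z) q) colours

  eliminate : Constraints → Vertex G → Constraints
  eliminate M v = filterᵇ (survives M v) M

  eliminateAll : Constraints → List (Vertex G) → Constraints
  eliminateAll = foldl eliminate

  permits-elim : ∀ M p q → T (permits M p q) → (p , q) ∈ˡ M
  permits-elim M p q t with any-elim (λ (p′ , q′) → sameLiteral p p′ ∧ sameLiteral q q′) M t
  ... | (p′ , q′) , ∈M , s with ∧-elim (sameLiteral p p′) s
  ...   | s₁ , s₂ with refl ← sameLiteral⇒≡ p p′ s₁ | refl ← sameLiteral⇒≡ q q′ s₂ = ∈M

  permits-intro : ∀ M p q → (p , q) ∈ˡ M → T (permits M p q)
  permits-intro M p q ∈M = any-intro (λ (p′ , q′) → sameLiteral p p′ ∧ sameLiteral q q′) ∈M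
    (∧-intro (sameLiteral p p) (sameLiteral-refl p) (sameLiteral-refl q))

  Supports : Constraints → Literal G → Literal G → Set
  Supports M r p = (r , r) ∈ˡ M × (p , r) ∈ˡ M × (r , p) ∈ˡ M

  supports-elim : ∀ M r p → T (supports M r p) → Supports M r p
  supports-elim M r p t =
    let rr , t′ = ∧-elim (permits M r r) t ; pr , rp = ∧-elim (permits M p r) t′ in
    permits-elim M r r rr , permits-elim M p r pr , permits-elim M r p rp

  supports-intro : ∀ M r p → Supports M r p → T (supports M r p)
  supports-intro M r p (rr , pr , rp) =
    ∧-intro (permits M r r) (permits-intro M r r rr)
      (∧-intro (permits M p r) (permits-intro M p r pr) (permits-intro M r p rp))

  eliminate-elim : ∀ M v {p q} → (p , q) ∈ˡ eliminate M v →
                   (p , q) ∈ˡ M × ∃[ z ] (Supports M (v , z) p × Supports M (v , z) q)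
  eliminate-elim M v {p} {q} ∈M′ =
    let ∈M , t    = filterᵇ-elim (survives M v) M ∈M′
        z , _ , s = any-elim (λ z → supports M (v , z) p ∧ supports M (v , z) q) colours t
        s₁ , s₂   = ∧-elim (supports M (v , z) p) s
    in ∈M , z , supports-elim M (v , z) p s₁ , supports-elim M (v , z) q s₂

  eliminateAll-⊆ : ∀ M vs {m} → m ∈ˡ eliminateAll M vs → m ∈ˡ M
  eliminateAll-⊆ M []       ∈M = ∈M
  eliminateAll-⊆ M (v ∷ vs) ∈M = proj₁ (eliminate-elim M v (eliminateAll-⊆ (eliminate M v) vs ∈M))

  Solution : Constraints → List (Literal G) → Set
  Solution M τ = ∀ {p q} → p ∈ˡ τ → q ∈ˡ τ → (p , q) ∈ˡ M

  -- This is where two colours per vertex are needed: three colours fail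
  -- to have this Helly property.
  helly : ∀ {A : Set} {P Q : A → Set} → Decidable P → (xs : List A) →
          (∀ {x y} → x ∈ˡ xs → y ∈ˡ xs → (P x × P y) ⊎ (Q x × Q y)) → All P xs ⊎ All Q xs
  helly {P = P} {Q} P? xs common with All.all? P? xs
  ... | yes all-P = inj₁ all-P
  ... | no ¬all-P with find (¬All⇒Any¬ P? xs ¬all-P)
  ... | x , x∈ , ¬Px = inj₂ (All.tabulate λ y∈ → [ (λ PP → ⊥-elim (¬Px (proj₁ PP))) , proj₂ ]′ (common x∈ y∈))

  _≟ˡ_ : DecidableEquality (Literal G)
  _≟ˡ_ = ≡-dec Finₚ._≟_ _≟ᶜ_

  supports? : ∀ M r → Decidable (Supports M r)
  supports? M r p = ((r , r) ∈ˡ? M) ×-dec ((p , r) ∈ˡ? M) ×-dec ((r , p) ∈ˡ? M)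
    where open DecMembership (≡-dec _≟ˡ_ _≟ˡ_) using () renaming (_∈?_ to _∈ˡ?_)

  -- Any two literals of τ have a common supporting colour at `v`, by the definition of elimination.
  -- With one colour of `v` forbidden only two are left, and `helly` turns pairwise support into a
  -- colour that supports all of τ.
  extend-solution : ∀ M v {τ} → (∃[ z₀ ] ¬ ((v , z₀) , (v , z₀)) ∈ˡ M) →
    (∃[ m ] m ∈ˡ eliminate M v) → Solution (eliminate M v) τ → ∃[ z ] Solution M ((v , z) ∷ τ)
  extend-solution M v {τ} (z₀ , z₀∉) (_ , m∈) sol = choose τ sol
    where
    extend : ∀ {τ z} → (∀ {p q} → p ∈ˡ τ → q ∈ˡ τ → (p , q) ∈ˡ M) →
             ((v , z) , (v , z)) ∈ˡ M → (∀ {p} → p ∈ˡ τ → Supports M (v , z) p) → Solution M ((v , z) ∷ τ)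
    extend old rr sup (here refl) (here refl) = rr
    extend old rr sup (here refl) (there q∈)  = proj₂ (proj₂ (sup q∈))
    extend old rr sup (there p∈)  (here refl) = proj₁ (proj₂ (sup p∈))
    extend old rr sup (there p∈)  (there q∈)  = old p∈ q∈
    choose : ∀ τ → Solution (eliminate M v) τ → ∃[ z ] Solution M ((v , z) ∷ τ)
    -- An empty τ offers no pair from which to read a colour of `v`; the surviving entry `m∈`
    -- provides one.
    choose [] sol = let _ , z , (rr , _) , _ = eliminate-elim M v m∈ in
      z , extend (λ ()) rr (λ ())
    choose τ@(t ∷ _) sol = conclude (helly (supports? M (v , z₁)) τ common)
      where
      z₁ = proj₁ (remaining z₀)
      z₂ = proj₁ (proj₂ (remaining z₀))
      common : ∀ {p q} → p ∈ˡ τ → q ∈ˡ τ → (Supports M (v , z₁) p × Supports M (v , z₁) q)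
                                          ⊎ (Supports M (v , z₂) p × Supports M (v , z₂) q)
      common p∈ q∈ =
        let _ , z , s₁ , s₂ = eliminate-elim M v (sol p∈ q∈) in
        split z s₁ s₂ (proj₂ (proj₂ (remaining z₀)) z λ z≡z₀ →
          z₀∉ (subst (λ z → ((v , z) , (v , z)) ∈ˡ M) z≡z₀ (proj₁ s₁)))
        where
        split : ∀ z {p q} → Supports M (v , z) p → Supports M (v , z) q → z ≡ z₁ ⊎ z ≡ z₂ →
                (Supports M (v , z₁) p × Supports M (v , z₁) q) ⊎ (Supports M (v , z₂) p × Supports M (v , z₂) q)
        split _ s₁ s₂ (inj₁ refl) = inj₁ (s₁ , s₂)
        split _ s₁ s₂ (inj₂ refl) = inj₂ (s₁ , s₂)
      old : ∀ {p q} → p ∈ˡ τ → q ∈ˡ τ → (p , q) ∈ˡ M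
      old p∈ q∈ = proj₁ (eliminate-elim M v (sol p∈ q∈))
      conclude : All (Supports M (v , z₁)) τ ⊎ All (Supports M (v , z₂)) τ → ∃[ z ] Solution M ((v , z) ∷ τ)
      conclude (inj₁ a@((rr , _) ∷ _)) = z₁ , extend old rr (All.lookup a)
      conclude (inj₂ a@((rr , _) ∷ _)) = z₂ , extend old rr (All.lookup a)

  -- Colours are chosen in the opposite order, from the last vertex eliminated back to the first. An
  -- entry left at the end was there at every stage, since constraints only shrink.
  eliminateAll-sound : ∀ M vs → (∀ v → ∃[ z₀ ] ¬ ((v , z₀) , (v , z₀)) ∈ˡ M) →
    (∃[ m ] m ∈ˡ eliminateAll M vs) → ∃[ τ ] (map proj₁ τ ≡ vs × Solution M τ)
  eliminateAll-sound M []       forb ne = [] , refl , λ ()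
  eliminateAll-sound M (v ∷ vs) forb (m , m∈) =
    let τ , eq , sol = eliminateAll-sound (eliminate M v) vs forb′ (m , m∈)
        z , sol′     = extend-solution M v (forb v) (m , eliminateAll-⊆ (eliminate M v) vs m∈) sol
    in (v , z) ∷ τ , cong (v ∷_) eq , sol′
    where
    forb′ : ∀ u → ∃[ z₀ ] ¬ ((u , z₀) , (u , z₀)) ∈ˡ eliminate M v
    forb′ u = proj₁ (forb u) , λ ∈M′ → proj₂ (forb u) (proj₁ (eliminate-elim M v ∈M′))

  -- When `x` is eliminated, `φ x` supports every pair of literals of `φ`, so none of these pairs is
  -- deleted.
  eliminateAll-complete : ∀ M vs (φ : Vertex G → Colour) → (∀ u v → ((u , φ u) , (v , φ v)) ∈ˡ M) →
                          ∀ u v → ((u , φ u) , (v , φ v)) ∈ˡ eliminateAll M vs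
  eliminateAll-complete M []       φ good = good
  eliminateAll-complete M (x ∷ vs) φ good = eliminateAll-complete (eliminate M x) vs φ λ u v →
    filterᵇ-intro (survives M x) (good u v)
      (any-intro (λ z → supports M (x , z) (u , φ u) ∧ supports M (x , z) (v , φ v)) (∈-colours (φ x))
        (∧-intro (supports M (x , φ x) (u , φ u)) (supported u) (supported v)))
    where
    supported : ∀ u → T (supports M (x , φ x) (u , φ u))
    supported u = supports-intro M (x , φ x) (u , φ u) (good x x , good u x , good x u)

-- The search

-- D is the list of the vertices of the dominating set; a list of pins
-- fixes the colours of some vertices.
module _ (G : Graph) (D : List (Vertex G)) where

  vertices : List (Vertex G)
  vertices = allFin (order G)

  literals : List (Literal G)
  literals = cartesianProduct vertices colours

  -- The second condition makes the guess of the separator vertices in D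
  -- exhaustive.
  admissible : List (Literal G) → Literal G → Bool
  admissible pins (v , z) = all (compatible G (v , z)) pins ∧
    (not (any (sameVertex G v) D) ∨ not (isCut z) ∨ any (sameLiteral G (v , z)) pins)

  -- One round of propagation suffices: under a correct guess each vertex of `D` has a single
  -- admissible colour, and every vertex that was not branched on is in `D` or next to it.
  arcConsistent : List (Literal G) → Literal G → Bool
  arcConsistent pins p = admissible pins p ∧
    all (λ u → any (λ w → admissible pins (u , w) ∧ compatible G (u , w) p) colours) D

  -- Elimination is sound only if every vertex has a forbidden colour. Wrong guesses may violate
  -- this, so it is tested at run time.
  twoColours : List (Literal G) → Bool
  twoColours pins = all (λ v → any (λ z → not (arcConsistent pins (v , z))) colours) vertices

  constraints : List (Literal G) → Constraints G
  constraints pins = filterᵇ (λ (p , q) → compatible G p q) (cartesianProduct lits lits)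
    where lits = filterᵇ (arcConsistent pins) literals

  -- `any (λ _ → true)` tests for a nonempty list: what survives the elimination of all vertices
  -- certifies satisfiability.
  verify : List (Literal G) → Bool
  verify pins = twoColours pins ∧ any (λ _ → true) (eliminateAll G (constraints pins) vertices)

  -- Verifying at every level tries all lists of length at most `m`, since the guessed independent
  -- sets may be smaller than their bound.
  guess : ℕ → List (Literal G) → Bool
  guess zero    pins = verify pins
  guess (suc m) pins = verify pins ∨ any (λ p → guess m (p ∷ pins)) literals

  -- Pinning a vertex to each side rules out the colourings that leave a side empty and so separate
  -- nothing.
  check : ℕ → List (Literal G) → Bool
  check m pins = any (λ u → any (λ v → guess m ((u , side₁) ∷ (v , side₂) ∷ pins)) vertices) vertices

  branch : ℕ → List (Literal G) → List (Vertex G) → Bool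
  branch m pins []       = check m pins
  branch m pins (x ∷ xs) = any (λ z → branch m ((x , z) ∷ pins) xs) colours

  constraints-elim : ∀ pins {p q} → (p , q) ∈ˡ constraints pins →
                     T (compatible G p q) × T (arcConsistent pins p)
  constraints-elim pins {p} {q} pq∈ =
    let pq∈′ , pq~ = filterᵇ-elim (λ (p , q) → compatible G p q) (cartesianProduct lits lits) pq∈
        p∈ , _     = ∈-cartesianProduct⁻ lits lits pq∈′
    in pq~ , proj₂ (filterᵇ-elim (arcConsistent pins) literals p∈)
    where lits = filterᵇ (arcConsistent pins) literals

  solution-sound : ∀ pins τ → map proj₁ τ ≡ vertices → Solution G (constraints pins) τ →
    ∃[ φ ] (ProperColouring G φ × ∀ {v z} → (v , z) ∈ˡ pins → φ v ≡ z)
  solution-sound pins τ eq τ∈ = φ , proper , pinned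
    where
    coloured : ∀ v → ∃[ z ] (v , z) ∈ˡ τ
    coloured v =
      let (_ , z) , z∈ , v≡ = ∈-map⁻ proj₁ (subst (v ∈ˡ_) (sym eq) (∈-allFin v))
      in z , subst (λ v → (v , z) ∈ˡ τ) (sym v≡) z∈
    φ : Vertex G → Colour
    φ v = proj₁ (coloured v)
    φ∈ : ∀ u v → ((u , φ u) , (v , φ v)) ∈ˡ constraints pins
    φ∈ u v = τ∈ (proj₂ (coloured u)) (proj₂ (coloured v))
    proper : ProperColouring G φ
    proper u v = compatible-touch G u v (φ u) (φ v) (proj₁ (constraints-elim pins (φ∈ u v)))
    pinned : ∀ {v z} → (v , z) ∈ˡ pins → φ v ≡ z
    -- Admissibility compares `(v , φ v)` with all pins, in particular with a pin at `v` itself.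
    pinned {v} {z} p∈ = compatible-≡ G v (φ v) z (all-elim (compatible G (v , φ v))
      (proj₁ (∧-elim (all (compatible G (v , φ v)) pins) (proj₁ (∧-elim (admissible pins (v , φ v))
        (proj₂ (constraints-elim pins (φ∈ v v))))))) p∈)

  verify-sound : ∀ pins → T (verify pins) →
    ∃[ φ ] (ProperColouring G φ × ∀ {v z} → (v , z) ∈ˡ pins → φ v ≡ z)
  verify-sound pins t =
    let two , t′       = ∧-elim (twoColours pins) t
        m , m∈ , _     = any-elim (λ _ → true) (eliminateAll G (constraints pins) vertices) t′
        τ , eq , τ∈    = eliminateAll-sound G (constraints pins) vertices (forbidden two) (m , m∈)
    in solution-sound pins τ eq τ∈
    where
    forbidden : T (twoColours pins) → ∀ v → ∃[ z ] ¬ ((v , z) , (v , z)) ∈ˡ constraints pins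
    forbidden two v =
      let z , _ , n = any-elim (λ z → not (arcConsistent pins (v , z))) colours
                        (all-elim (λ v → any (λ z → not (arcConsistent pins (v , z))) colours) two (∈-allFin v))
      in z , λ vv∈ → not-elim n (proj₂ (constraints-elim pins vv∈))

  guess-sound : ∀ m pins → T (guess m pins) →
    ∃[ pins′ ] ((∀ {p} → p ∈ˡ pins → p ∈ˡ pins′) × T (verify pins′))
  guess-sound zero    pins t = pins , id , t
  guess-sound (suc m) pins t with ∨-elim (verify pins) t
  ... | inj₁ t′ = pins , id , t′
  ... | inj₂ t′ =
    let p , _ , t″          = any-elim (λ p → guess m (p ∷ pins)) literals t′
        pins′ , pins⊆ , t‴ = guess-sound m (p ∷ pins) t″
    in pins′ , pins⊆ ∘ there , t‴

  branch-sound : ∀ m pins xs → T (branch m pins xs) → ∃[ pins′ ] T (check m pins′)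
  branch-sound m pins []       t = pins , t
  branch-sound m pins (x ∷ xs) t =
    let z , _ , t′ = any-elim (λ z → branch m ((x , z) ∷ pins) xs) colours t
    in branch-sound m ((x , z) ∷ pins) xs t′

  TwoSided : (Vertex G → Colour) → Set
  TwoSided φ = (∃[ u ] φ u ≡ side₁) × (∃[ v ] φ v ≡ side₂)

  check-sound : ∀ m pins → T (check m pins) → ∃[ φ ] (ProperColouring G φ × TwoSided φ)
  check-sound m pins t =
    let u , _ , t′        = any-elim (λ u → any (λ v → guess m ((u , side₁) ∷ (v , side₂) ∷ pins)) vertices)
                              vertices t
        v , _ , t″        = any-elim (λ v → guess m ((u , side₁) ∷ (v , side₂) ∷ pins)) vertices t′
        pins′ , ⊆pins′ , t‴ = guess-sound m ((u , side₁) ∷ (v , side₂) ∷ pins) t″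
        φ , proper , pinned = verify-sound pins′ t‴
    in φ , proper , (u , pinned (⊆pins′ (here refl))) , (v , pinned (⊆pins′ (there (here refl))))

  module _ {φ : Vertex G → Colour} (proper : ProperColouring G φ) where

    infix 4 _⊆φ
    _⊆φ : List (Literal G) → Set
    pins ⊆φ = ∀ {v z} → (v , z) ∈ˡ pins → φ v ≡ z

    -- The pins leave only one admissible colour for u.
    Determined : List (Literal G) → Vertex G → Set
    Determined pins u = (u , φ u) ∈ˡ pins ⊎
      (φ u ≢ cut × ∃[ v ] (Adjacent G u v × (v , φ u) ∈ˡ pins))

    Covered : List (Literal G) → Vertex G → Set
    Covered pins v = (v , φ v) ∈ˡ pins ⊎ v ∈ˡ D ⊎ (∃[ u ] (u ∈ˡ D × Adjacent G u v))

    module _ (pins : List (Literal G)) (pins⊆φ : pins ⊆φ)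
             (determined : ∀ {u} → u ∈ˡ D → Determined pins u) where

      admissible-pin : ∀ {v z u w} → T (admissible pins (v , z)) → (u , w) ∈ˡ pins →
                       T (compatible G (v , z) (u , w))
      admissible-pin {v} {z} t = all-elim (compatible G (v , z))
        (proj₁ (∧-elim (all (compatible G (v , z)) pins) t))

      admissible-cut : ∀ {v} → v ∈ˡ D → T (admissible pins (v , cut)) → φ v ≡ cut
      admissible-cut {v} v∈D t =
        let p , p∈ , v≡ = any-elim (sameLiteral G (v , cut)) pins
              (⇒-elim (any (sameVertex G v) D) (proj₂ (∧-elim (all (compatible G (v , cut)) pins) t))
                 (any-intro (sameVertex G v) v∈D (≡⇒sameVertex G v refl)))
        in pins⊆φ (subst (_∈ˡ pins) (sym (sameLiteral⇒≡ G (v , cut) p v≡)) p∈)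

      admissible-φ : ∀ v → T (admissible pins (v , φ v))
      admissible-φ v = ∧-intro (all (compatible G (v , φ v)) pins)
        (all-intro (compatible G (v , φ v)) pins λ {(u , w)} p∈ →
          subst (λ w → T (compatible G (v , φ v) (u , w))) (pins⊆φ p∈) (proper⇒compatible G proper v u))
        (⇒-intro (any (sameVertex G v) D) λ v∈D → ⇒-intro (isCut (φ v)) λ v-cut →
          any-intro (sameLiteral G (v , φ v)) (pinned (D-member v∈D) (isCut⇒≡ (φ v) v-cut))
            (sameLiteral-refl G (v , φ v)))
        where
        D-member : T (any (sameVertex G v) D) → v ∈ˡ D
        D-member t = let u , u∈ , v≡u = any-elim (sameVertex G v) D t in
          subst (_∈ˡ D) (sym (sameVertex⇒≡ G v u v≡u)) u∈
        pinned : v ∈ˡ D → φ v ≡ cut → (v , φ v) ∈ˡ pins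
        pinned v∈D v-cut with determined v∈D
        ... | inj₁ p∈         = p∈
        ... | inj₂ (≢cut , _) = ⊥-elim (≢cut v-cut)

      -- If `u` is not pinned, its pinned neighbour in the same side excludes the opposite side, and
      -- `admissible-cut` excludes cut.
      admissible-unique : ∀ {u w} → u ∈ˡ D → T (admissible pins (u , w)) → w ≡ φ u
      admissible-unique {u} {w} u∈D t with determined u∈D
      ... | inj₁ p∈ = compatible-≡ G u w (φ u) (admissible-pin t p∈)
      ... | inj₂ (≢cut , v , u~v , p∈) = touch-side ≢cut
              (compatible-touch G u v w (φ u) (admissible-pin t p∈) u~v)
              λ { refl → ≢cut (admissible-cut u∈D t) }

      arcConsistent-φ : ∀ v → T (arcConsistent pins (v , φ v))
      arcConsistent-φ v = ∧-intro (admissible pins (v , φ v)) (admissible-φ v)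
        (all-intro (λ u → any (λ w → admissible pins (u , w) ∧ compatible G (u , w) (v , φ v)) colours) D
          λ {u} _ → any-intro (λ w → admissible pins (u , w) ∧ compatible G (u , w) (v , φ v)) (∈-colours (φ u))
            (∧-intro (admissible pins (u , φ u)) (admissible-φ u) (proper⇒compatible G proper u v)))

      module _ (covered : ∀ v → Covered pins v) where

        -- A vertex that is pinned or in `D` has a forced colour and excludes any other; a vertex
        -- dominated by `u₀` excludes the colour that clashes with the forced colour of `u₀`.
        excluded : ∀ v → ∃[ z ] ¬ T (arcConsistent pins (v , z))
        excluded v with covered v
        ... | inj₁ p∈ = let z , z≢ = another (φ v) in z , λ t →
              z≢ (compatible-≡ G v z (φ v) (admissible-pin (proj₁ (∧-elim (admissible pins (v , z)) t)) p∈))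
        ... | inj₂ (inj₁ v∈D) = let z , z≢ = another (φ v) in z , λ t →
              z≢ (admissible-unique v∈D (proj₁ (∧-elim (admissible pins (v , z)) t)))
        ... | inj₂ (inj₂ (u₀ , u∈D , u~v)) = clash (φ u₀) , λ t →
              let w , _ , s = any-elim (λ w → admissible pins (u₀ , w) ∧ compatible G (u₀ , w) (v , clash (φ u₀)))
                    colours (all-elim (λ u → any (λ w → admissible pins (u , w) ∧
                                                 compatible G (u , w) (v , clash (φ u₀))) colours)
                      (proj₂ (∧-elim (admissible pins (v , clash (φ u₀))) t)) u∈D)
                  s₁ , s₂ = ∧-elim (admissible pins (u₀ , w)) s
              in ¬touch-clash (φ u₀) (subst (λ w → T (touch w (clash (φ u₀)))) (admissible-unique u∈D s₁)
                   (compatible-touch G u₀ v w (clash (φ u₀)) s₂ u~v))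

        constraints-φ : ∀ u v → ((u , φ u) , (v , φ v)) ∈ˡ constraints pins
        constraints-φ u v = filterᵇ-intro (λ (p , q) → compatible G p q)
          (∈-cartesianProduct⁺ (literal∈ u) (literal∈ v)) (proper⇒compatible G proper u v)
          where
          literal∈ : ∀ v → (v , φ v) ∈ˡ filterᵇ (arcConsistent pins) literals
          literal∈ v = filterᵇ-intro (arcConsistent pins)
            (∈-cartesianProduct⁺ (∈-allFin v) (∈-colours (φ v))) (arcConsistent-φ v)

        -- The vertex guarantees that `φ` contributes at least one pair to the constraints, so that
        -- the surviving list is not empty.
        verify-complete : Vertex G → T (verify pins)
        verify-complete v = ∧-intro (twoColours pins)
          (all-intro (λ v → any (λ z → not (arcConsistent pins (v , z))) colours) vertices λ {v} _ →
            any-intro (λ z → not (arcConsistent pins (v , z))) (∈-colours (proj₁ (excluded v)))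
              (not-intro (proj₂ (excluded v))))
          (any-intro (λ _ → true) (eliminateAll-complete G (constraints pins) vertices φ constraints-φ v v) tt)

    -- Each guessed literal is pushed on the front of the pins, so the list `g` arrives reversed;
    -- hence `ʳ++`.
    guess-complete : ∀ m g pins → length g ≤ m → T (verify (g ʳ++ pins)) → T (guess m pins)
    guess-complete zero    []      pins g≤ t = t
    guess-complete (suc m) []      pins g≤ t with verify pins
    ... | true = tt
    guess-complete (suc m) (p ∷ g) pins g≤ t = ∨-introʳ (verify pins)
      (any-intro (λ p → guess m (p ∷ pins))
        (∈-cartesianProduct⁺ (∈-allFin (proj₁ p)) (∈-colours (proj₂ p)))
        (guess-complete m g (p ∷ pins) (s≤s⁻¹ g≤) t))

    branch-complete : ∀ m pins xs → T (check m (map (λ v → v , φ v) xs ʳ++ pins)) → T (branch m pins xs)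
    branch-complete m pins []       t = t
    branch-complete m pins (x ∷ xs) t = any-intro (λ z → branch m ((x , z) ∷ pins) xs) (∈-colours (φ x))
      (branch-complete m ((x , φ x) ∷ pins) xs t)

    search-complete : ∀ m xs g → TwoSided φ → length g ≤ m → g ⊆φ →
      (∀ {u} → u ∈ˡ D → Determined g u) →
      (∀ v → v ∈ˡ xs ⊎ v ∈ˡ D ⊎ (∃[ u ] (u ∈ˡ D × Adjacent G u v))) →
      T (branch m [] xs)
    search-complete m xs g ((u , φu) , (v , φv)) g≤ g⊆φ determined covered = branch-complete m [] xs
      (any-intro (λ u → any (λ v → guess m ((u , side₁) ∷ (v , side₂) ∷ pins)) vertices) (∈-allFin u)
        (any-intro (λ v → guess m ((u , side₁) ∷ (v , side₂) ∷ pins)) (∈-allFin v)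
          (guess-complete m g sides g≤
            (verify-complete (g ʳ++ sides) all⊆φ determined′ covered′ u))))
      where
      pins sides : List (Literal G)
      pins  = map (λ v → v , φ v) xs ʳ++ []
      sides = (u , side₁) ∷ (v , side₂) ∷ pins
      pins⊆φ : pins ⊆φ
      pins⊆φ p∈ with reverseAcc⁻ [] (map (λ v → v , φ v) xs) p∈
      ... | inj₂ p∈′ with ∈-map⁻ (λ v → v , φ v) p∈′
      ... | _ , _ , refl = refl
      all⊆φ : g ʳ++ sides ⊆φ
      all⊆φ p∈ with reverseAcc⁻ sides g p∈
      ... | inj₁ (here refl)         = φu
      ... | inj₁ (there (here refl)) = φv
      ... | inj₁ (there (there p∈′)) = pins⊆φ p∈′
      ... | inj₂ p∈′                 = g⊆φ p∈′
      g⊆ : ∀ {p} → p ∈ˡ g → p ∈ˡ g ʳ++ sides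
      g⊆ p∈ = reverseAcc⁺ sides g (inj₂ p∈)
      determined′ : ∀ {u} → u ∈ˡ D → Determined (g ʳ++ sides) u
      determined′ u∈D with determined u∈D
      ... | inj₁ p∈                    = inj₁ (g⊆ p∈)
      ... | inj₂ (≢cut , v , u~v , p∈) = inj₂ (≢cut , v , u~v , g⊆ p∈)
      covered′ : ∀ v → Covered (g ʳ++ sides) v
      covered′ v with covered v
      ... | inj₁ v∈ = inj₁ (reverseAcc⁺ sides g (inj₁ (there (there
                        (reverseAcc⁺ [] (map (λ v → v , φ v) xs) (inj₂ (∈-map⁺ (λ v → v , φ v) v∈)))))))
      ... | inj₂ c  = inj₂ c

-- Enumeration of vertex sets and maximal independent sets of a colour class

nth-∈ : ∀ {n} (S : Subset n) i → nth S i ∈ S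
nth-∈ (inside  ∷ S) zero    = here
nth-∈ (inside  ∷ S) (suc i) = there (nth-∈ S i)
nth-∈ (outside ∷ S) i       = there (nth-∈ S i)

index : ∀ {n} {S : Subset n} {v} → v ∈ S → ∃[ i ] nth S i ≡ v
index {S = inside  ∷ S} here       = zero , refl
index {S = inside  ∷ S} (there v∈) = let i , eq = index v∈ in suc i , cong suc eq
index {S = outside ∷ S} (there v∈) = let i , eq = index v∈ in i , cong suc eq

elements : ∀ {n} → Subset n → List (Fin n)
elements S = filterᵇ (lookup S) (allFin _)

∈⇒∈-elements : ∀ {n} {S : Subset n} {v} → v ∈ S → v ∈ˡ elements S
∈⇒∈-elements {S = S} {v} v∈ =
  filterᵇ-intro (lookup S) (∈-allFin v) (Equivalence.from T-≡ ([]=⇒lookup v∈))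

∈-elements⇒∈ : ∀ {n} {S : Subset n} {v} → v ∈ˡ elements S → v ∈ S
∈-elements⇒∈ {S = S} {v} v∈ =
  lookup⇒[]= v S (Equivalence.to T-≡ (proj₂ (filterᵇ-elim (lookup S) (allFin _) v∈)))

∈-subsets : ∀ {n} (S : Subset n) → S ∈ˡ subsets n
∈-subsets []            = here refl
∈-subsets (outside ∷ S) = ∈-++⁺ˡ (∈-map⁺ (outside ∷_) (∈-subsets S))
∈-subsets (inside  ∷ S) = ∈-++⁺ʳ (map (outside ∷_) (subsets _)) (∈-map⁺ (inside ∷_) (∈-subsets S))

independent⇒≤α : ∀ G {S} → Independent G S → ∣ S ∣ ≤ α G
independent⇒≤α G {S} ind = v≤max⁺ 0 _
  (inj₂ (map⁺ (lose (∈-filter⁺ (Independent? G) (∈-subsets S) ind) ≤-refl)))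

module _ (K : Graph) (ψ : Vertex K → Colour) (z : Colour) where

  -- Maximality is relative to `vs` so that the greedy construction can recurse on the list: a
  -- vertex of colour `z` is either added or has a neighbour in the set, which is what `maximal`
  -- asks.
  record MaximalIndependent (vs : List (Vertex K)) : Set where
    field
      set         : VertexSet K
      independent : Independent K set
      coloured    : ∀ {i} → i ∈ set → ψ i ≡ z
      maximal     : ∀ {i} → i ∈ˡ vs → ψ i ≡ z → i ∈ set ⊎ ∃[ j ] (j ∈ set × Adjacent K i j)

  greedy : ∀ vs → MaximalIndependent vs
  greedy [] = record
    { set = ∅ ; independent = λ u v u∈ → ⊥-elim (∉⊥ u∈)
    ; coloured = λ i∈ → ⊥-elim (∉⊥ i∈) ; maximal = λ () }
  greedy (v ∷ vs) = decide (ψ v ≟ᶜ z) (any? λ j → (j ∈? set) ×-dec T? (adj K v j))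
    where
    open MaximalIndependent (greedy vs)
    keep : (ψ v ≡ z → ∃[ j ] (j ∈ set × Adjacent K v j)) → MaximalIndependent (v ∷ vs)
    keep f = record
      { set = set ; independent = independent ; coloured = coloured
      ; maximal = λ { (here refl) v-z → inj₂ (f v-z) ; (there i∈) → maximal i∈ } }
    decide : Dec (ψ v ≡ z) → Dec (∃[ j ] (j ∈ set × Adjacent K v j)) → MaximalIndependent (v ∷ vs)
    decide (no v≢z) _          = keep λ v-z → ⊥-elim (v≢z v-z)
    decide (yes _)  (yes nbr)  = keep λ _ → nbr
    decide (yes v-z) (no ¬nbr) = record
      { set         = set ∪ ⁅ v ⁆
      ; independent = λ i j i∈ j∈ → indep i j (x∈p∪q⁻ set ⁅ v ⁆ i∈) (x∈p∪q⁻ set ⁅ v ⁆ j∈)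
      ; coloured    = λ i∈ → [ coloured , (λ i∈v → trans (cong ψ (x∈⁅y⁆⇒x≡y v i∈v)) v-z) ]′
                               (x∈p∪q⁻ set ⁅ v ⁆ i∈)
      ; maximal     = λ
          { (here refl) _   → inj₁ (x∈p∪q⁺ (inj₂ (x∈⁅x⁆ v)))
          ; (there i∈)  i-z → [ (λ i∈set → inj₁ (x∈p∪q⁺ (inj₁ i∈set)))
                              , (λ (j , j∈ , i~j) → inj₂ (j , x∈p∪q⁺ (inj₁ j∈) , i~j)) ]′ (maximal i∈ i-z) } }
      where
      indep : ∀ i j → i ∈ set ⊎ i ∈ ⁅ v ⁆ → j ∈ set ⊎ j ∈ ⁅ v ⁆ → ¬ Adjacent K i j
      indep i j (inj₁ i∈) (inj₁ j∈) i~j = independent i j i∈ j∈ i~j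
      indep i j (inj₁ i∈) (inj₂ j∈) i~j with refl ← x∈⁅y⁆⇒x≡y v j∈ =
        ¬nbr (i , i∈ , subst T (symmetric K i v) i~j)
      indep i j (inj₂ i∈) (inj₁ j∈) i~j with refl ← x∈⁅y⁆⇒x≡y v i∈ = ¬nbr (j , j∈ , i~j)
      indep i j (inj₂ i∈) (inj₂ j∈) i~j
        with refl ← x∈⁅y⁆⇒x≡y v i∈ | refl ← x∈⁅y⁆⇒x≡y v j∈ = subst T (irreflexive K v) i~j

  maximalIndependent : MaximalIndependent (allFin (order K))
  maximalIndependent = greedy (allFin (order K))

-- Cutsets and colourings

module _ (G : Graph) where

  -- No edge joins the two sides, so a walk that avoids the cut never leaves side₁.
  colouring⇒cutset : ∀ {φ} → ProperColouring G φ → (∃[ u ] φ u ≡ side₁) → (∃[ v ] φ v ≡ side₂) →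
                     HasIndependentCutset G
  colouring⇒cutset {φ} proper (u , φu) (v , φv) = S , cutset , independent
    where
    S : VertexSet G
    S = tabulate (isCut ∘ φ)
    ∈S⇒cut : ∀ {v} → v ∈ S → φ v ≡ cut
    ∈S⇒cut {v} v∈ = isCut⇒≡ (φ v)
      (Equivalence.from T-≡ (trans (sym (lookup∘tabulate (isCut ∘ φ) v)) ([]=⇒lookup v∈)))
    cut⇒∈S : ∀ {v} → φ v ≡ cut → v ∈ S
    cut⇒∈S {v} v-cut = lookup⇒[]= v S (trans (lookup∘tabulate (isCut ∘ φ) v) (cong isCut v-cut))
    independent : Independent G S
    independent u v u∈ v∈ u~v = clashing (∈S⇒cut u∈) (∈S⇒cut v∈) (proper u v u~v)
      where
      clashing : ∀ {w z} → w ≡ cut → z ≡ cut → ¬ T (touch w z)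
      clashing refl refl ()
    outer : ∀ {v z} → φ v ≡ z → z ≢ cut → ∃[ i ] nth (∁ S) i ≡ v
    outer v-z z≢ = index (x∉p⇒x∈∁p λ v∈ → z≢ (trans (sym v-z) (∈S⇒cut v∈)))
    stays : ∀ {i j} → Star (Adjacent (G − S)) i j → φ (nth (∁ S) i) ≡ side₁ → φ (nth (∁ S) j) ≡ side₁
    stays ε                   eq = eq
    stays (_◅_ {i} {j} i~j p) eq = stays p (touch-side {φ (nth (∁ S) j)} (λ ())
      (subst (λ z → T (touch (φ (nth (∁ S) j)) z)) eq
        (proper (nth (∁ S) j) (nth (∁ S) i) (subst T (symmetric (G − S) i j) i~j)))
      λ j-cut → x∈∁p⇒x∉p (nth-∈ (∁ S) j) (cut⇒∈S j-cut))
    cutset : Cutset G S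
    cutset connected =
      let i , eqᵢ = outer φu (λ ()) ; j , eqⱼ = outer φv (λ ())
      in side₁≢side₂ (trans (sym (stays (connected i j) (trans (cong φ eqᵢ) φu))) (trans (cong φ eqⱼ) φv))
      where
      side₁≢side₂ : side₁ ≢ side₂
      side₁≢side₂ ()

  -- Connectivity is decided only under a double negation, which is all
  -- that refuting the existence of a cutset needs.
  cutset⇒colouring : HasIndependentCutset G →
    ¬ ¬ (∃[ φ ] (ProperColouring G φ × (∃[ u ] φ u ≡ side₁) × (∃[ v ] φ v ≡ side₂)))
  cutset⇒colouring (S , cutset , independent) none =
    -- Double negation commutes with finite quantification, so connectivity of each single pair
    -- under double negation already refutes `cutset`; a pair that is not connected gives the
    -- colouring.
    sequence applicative (λ i → sequence applicative (λ j → linked i j)) cutset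
    where
    open RawMonad (¬¬-Monad {0ℓ}) using () renaming (rawApplicative to applicative)
    H : Graph
    H = G − S
    Reach : Vertex H → Vertex H → Set
    Reach = Star (Adjacent H)
    linked : ∀ i j → ¬ ¬ Reach i j
    linked i j ¬ij = sequence applicative (λ k → ¬¬-excluded-middle {A = Reach i k}) λ reach? →
      none (coloured reach?)
      where
      module _ (reach? : ∀ k → Dec (Reach i k)) where
        -- Side₁ is the component of `i` in `G − S`, side₂ everything else outside `S`; in
        -- particular `j` is in side₂.
        Meaning : Vertex G → Colour → Set
        Meaning v cut   = v ∈ S
        Meaning v side₁ = ∃[ k ] (nth (∁ S) k ≡ v × Reach i k)
        Meaning v side₂ = ∃[ k ] (nth (∁ S) k ≡ v × ¬ Reach i k)
        colour : ∀ v → ∃[ z ] Meaning v z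
        colour v with v ∈? S
        ... | yes v∈S = cut , v∈S
        ... | no  v∉S with index (x∉p⇒x∈∁p v∉S)
        ... | k , eq with reach? k
        ... | yes ik = side₁ , k , eq , ik
        ... | no ¬ik = side₂ , k , eq , ¬ik
        touching : ∀ {u v} w z → Meaning u w → Meaning v z → Adjacent G u v → T (touch w z)
        touching cut   cut   u∈ v∈ u~v = independent _ _ u∈ v∈ u~v
        touching cut   side₁ _ _ _ = tt
        touching cut   side₂ _ _ _ = tt
        touching side₁ cut   _ _ _ = tt
        touching side₁ side₁ _ _ _ = tt
        touching side₁ side₂ (k , refl , ik) (l , refl , ¬il) u~v = ¬il (ik ◅◅ u~v ◅ ε)
        touching side₂ cut   _ _ _ = tt
        touching side₂ side₁ (k , refl , ¬ik) (l , refl , il) u~v =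
          ¬ik (il ◅◅ subst T (symmetric G (nth (∁ S) k) (nth (∁ S) l)) u~v ◅ ε)
        touching side₂ side₂ _ _ _ = tt
        outside-S : ∀ k → nth (∁ S) k ∉ S
        outside-S k = x∈∁p⇒x∉p (nth-∈ (∁ S) k)
        nth-injective : ∀ {n} (P : Subset n) {k l} → nth P k ≡ nth P l → k ≡ l
        nth-injective (inside  ∷ P) {zero}  {zero}  eq = refl
        nth-injective (inside  ∷ P) {suc k} {suc l} eq = cong suc (nth-injective P (Finₚ.suc-injective eq))
        nth-injective (outside ∷ P) eq = nth-injective P (Finₚ.suc-injective eq)
        near : ∀ z → Meaning (nth (∁ S) i) z → z ≡ side₁
        near cut   v∈             = ⊥-elim (outside-S i v∈)
        near side₁ _              = refl
        near side₂ (k , eq , ¬ik) with refl ← nth-injective (∁ S) {k} {i} eq = ⊥-elim (¬ik ε)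
        far : ∀ z → Meaning (nth (∁ S) j) z → z ≡ side₂
        far cut   v∈            = ⊥-elim (outside-S j v∈)
        far side₁ (k , eq , ij) with refl ← nth-injective (∁ S) {k} {j} eq = ⊥-elim (¬ij ij)
        far side₂ _             = refl
        coloured : ∃[ φ ] (ProperColouring G φ × (∃[ u ] φ u ≡ side₁) × (∃[ v ] φ v ≡ side₂))
        coloured = proj₁ ∘ colour
          , (λ u v → touching _ _ (proj₂ (colour u)) (proj₂ (colour v)))
          , (nth (∁ S) i , near _ (proj₂ (colour (nth (∁ S) i))))
          , (nth (∁ S) j , far _ (proj₂ (colour (nth (∁ S) j))))

-- Correctness of the search

module _ (c : ℕ) (G : Graph) (X : VertexSet G) (Y : VertexSet (G − X)) where

  dominators : List (Vertex G)
  dominators = map (nth (∁ X)) (elements Y)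

  -- The number of guesses allows `c` pins for each of the three colours.
  decision : Bool
  decision = branch G dominators (c + (c + c)) [] (elements X)

  decision-sound : T decision → HasIndependentCutset G
  decision-sound t =
    let pins , t′ = branch-sound G dominators (c + (c + c)) [] (elements X) t
        φ , proper , one , two = check-sound G dominators (c + (c + c)) pins t′
    in colouring⇒cutset G proper one two

  module _ (αdominating : αDominating c (G − X) Y) where

    colouring⇒decision : ∀ {φ} → ProperColouring G φ → (∃[ u ] φ u ≡ side₁) → (∃[ v ] φ v ≡ side₂) →
                         T decision
    colouring⇒decision {φ} proper one two =
      search-complete G dominators proper (c + (c + c)) (elements X) pins (one , two) pins≤ pins⊆φ
        determined covered
      where
      K : Graph
      K = (G − X) [ Y ]
      e : Vertex K → Vertex G
      e i = nth (∁ X) (nth Y i)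
      module I z = MaximalIndependent (maximalIndependent K (φ ∘ e) z)
      pinned : Colour → List (Literal G)
      pinned z = List.tabulate (λ i → e (nth (I.set z) i) , z)
      pinned≤ : ∀ z → length (pinned z) ≤ c
      pinned≤ z = ≤-trans (≤-reflexive (length-tabulate _))
        (≤-trans (independent⇒≤α K (I.independent z)) (proj₂ αdominating))
      pinned⊆φ : ∀ z {v w} → (v , w) ∈ˡ pinned z → φ v ≡ w
      pinned⊆φ z v∈ with ∈-tabulate⁻ v∈
      ... | i , refl = I.coloured z (nth-∈ (I.set z) i)
      ∈-pinned : ∀ z {i} → i ∈ I.set z → (e i , z) ∈ˡ pinned z
      ∈-pinned z i∈ with index i∈
      ... | j , refl = ∈-tabulate⁺ j
      pins : List (Literal G)
      pins = pinned cut ++ (pinned side₁ ++ pinned side₂)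
      pins≤ : length pins ≤ c + (c + c)
      pins≤ = ≤-trans (≤-reflexive (trans (length-++ (pinned cut))
                                     (cong (length (pinned cut) +_) (length-++ (pinned side₁)))))
        (+-mono-≤ (pinned≤ cut) (+-mono-≤ (pinned≤ side₁) (pinned≤ side₂)))
      pins⊆φ : ∀ {v w} → (v , w) ∈ˡ pins → φ v ≡ w
      pins⊆φ v∈ with ∈-++⁻ (pinned cut) v∈
      ... | inj₁ v∈₀ = pinned⊆φ cut v∈₀
      ... | inj₂ v∈′ with ∈-++⁻ (pinned side₁) v∈′
      ... | inj₁ v∈₁ = pinned⊆φ side₁ v∈₁
      ... | inj₂ v∈₂ = pinned⊆φ side₂ v∈₂
      pinned⊆pins : ∀ z {p} → p ∈ˡ pinned z → p ∈ˡ pins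
      pinned⊆pins cut   p∈ = ∈-++⁺ˡ p∈
      pinned⊆pins side₁ p∈ = ∈-++⁺ʳ (pinned cut) (∈-++⁺ˡ p∈)
      pinned⊆pins side₂ p∈ = ∈-++⁺ʳ (pinned cut) (∈-++⁺ʳ (pinned side₁) p∈)
      -- If `i` is not in the set of its colour, it has a neighbour there. That neighbour has the
      -- same colour, and an edge between two cut vertices is improper, so the common colour is a
      -- side.
      determined-K : ∀ i → Determined G dominators proper pins (e i)
      determined-K i with I.maximal (φ (e i)) (∈-allFin i) refl
      ... | inj₁ i∈             = inj₁ (pinned⊆pins (φ (e i)) (∈-pinned (φ (e i)) i∈))
      ... | inj₂ (j , j∈ , i~j) = inj₂ (not-cut , e j , i~j , pinned⊆pins (φ (e i)) (∈-pinned (φ (e i)) j∈))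
        where
        not-cut : φ (e i) ≢ cut
        not-cut i-cut = both-cut i-cut (trans (I.coloured (φ (e i)) j∈) i-cut) (proper (e i) (e j) i~j)
          where
          both-cut : ∀ {w z} → w ≡ cut → z ≡ cut → ¬ T (touch w z)
          both-cut refl refl ()
      determined : ∀ {u} → u ∈ˡ dominators → Determined G dominators proper pins u
      determined u∈ with ∈-map⁻ (nth (∁ X)) u∈
      ... | j , j∈ , refl with index (∈-elements⇒∈ {S = Y} j∈)
      ... | i , refl = determined-K i
      dominator : ∀ {j} → j ∈ Y → nth (∁ X) j ∈ˡ dominators
      dominator j∈ = ∈-map⁺ (nth (∁ X)) (∈⇒∈-elements j∈)
      covered : ∀ v → v ∈ˡ elements X ⊎ v ∈ˡ dominators ⊎ (∃[ u ] (u ∈ˡ dominators × Adjacent G u v))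
      covered v with v ∈? X
      ... | yes v∈X = inj₁ (∈⇒∈-elements v∈X)
      ... | no  v∉X with index (x∉p⇒x∈∁p v∉X)
      ... | i , refl with proj₁ αdominating i
      ... | inj₁ i∈Y             = inj₂ (inj₁ (dominator i∈Y))
      ... | inj₂ (j , j∈ , i~j) =
        inj₂ (inj₂ (nth (∁ X) j , dominator j∈ , subst T (symmetric G (nth (∁ X) i) (nth (∁ X) j)) i~j))

    decision-complete : HasIndependentCutset G → T decision
    -- A Boolean answer is stable, so a colouring that exists only under double negation is enough.
    decision-complete cutset = decidable-stable (T? decision) λ ¬t →
      cutset⇒colouring G cutset λ (φ , proper , one , two) → ¬t (colouring⇒decision proper one two)

-- Programs for the polynomial part of the search

encodePair : {A B : Set} → (A → Tree) → (B → Tree) → A × B → Tree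
encodePair eA eB ab = eA (proj₁ ab) ∙ eB (proj₂ ab)

encodeColour : Colour → Tree
encodeColour cut   = nil
encodeColour side₁ = nil ∙ nil
encodeColour side₂ = nil ∙ nil ∙ nil

encodeLiteral : ∀ {G} → Literal G → Tree
encodeLiteral = encodePair encodeFin encodeColour

encodeVertices : ∀ {G} → List (Vertex G) → Tree
encodeVertices = encodeList encodeFin

encodeLiterals : ∀ {G} → List (Literal G) → Tree
encodeLiterals {G} = encodeList (encodeLiteral {G})

encodeConstraints : ∀ {G} → Constraints G → Tree
encodeConstraints {G} = encodeList (encodePair (encodeLiteral {G}) (encodeLiteral {G}))

⟿-constant : {I : Set} {x : I → Tree} (t : Tree) → x ⟿ (λ _ → t)
⟿-constant nil     = ⟿-nil
⟿-constant (s ∙ t) = ⟿-constant s ⟿-∙ ⟿-constant t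

module _ {I : Set} {x : I → Tree} where

  ⟿-case : {z : I → Colour} {h : Colour → I → Tree} →
           x ⟿ encodeColour ∘ z → (∀ w → x ⟿ h w) → x ⟿ (λ i → h (z i) i)
  ⟿-case {z} {h} f g = ⟿-resp (λ i → cond-colour (z i) i)
    (⟿-cond f (⟿-cond (f ⟿-⨾ ⟿-right) (g side₂) (g side₁)) (g cut))
    where
    cond-colour : ∀ z i → cond (encodeColour z) (cond (right (encodeColour z)) (h side₂ i) (h side₁ i)) (h cut i)
                          ≡ h z i
    cond-colour cut   i = refl
    cond-colour side₁ i = refl
    cond-colour side₂ i = refl

  ⟿-binary : (h : Colour → Colour → Bool) {w z : I → Colour} →
    x ⟿ encodeColour ∘ w → x ⟿ encodeColour ∘ z → x ⟿ (λ i → encodeBool (h (w i) (z i)))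
  ⟿-binary h {w} {z} f g = ⟿-case {h = λ w i → encodeBool (h w (z i))} f λ w →
    ⟿-case {h = λ z i → encodeBool (h w z)} g λ z → ⟿-constant (encodeBool (h w z))

  ⟿-cartesianProduct : {A B : I → Set} {eA : ∀ {i} → A i → Tree} {eB : ∀ {i} → B i → Tree}
    {l : ∀ i → List (A i)} {m : ∀ i → List (B i)} →
    x ⟿ (λ i → encodeList eA (l i)) → x ⟿ (λ i → encodeList eB (m i)) →
    x ⟿ (λ i → encodeList (encodePair eA eB) (cartesianProduct (l i) (m i)))
  ⟿-cartesianProduct {A} {B} {eA} {eB} {l} {m} f g =
    ⟿-resp (λ i → cong (encodeList (encodePair eA eB)) (product (l i) (m i)))
      (⟿-concatMap {eA = eA} {eB = encodePair eA eB} {g = λ i a → map (a ,_) (m i)} f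
        (⟿-map {eA = eB} (⟿-weaken {eA = eA} g) {eB = encodePair eA eB} {g = λ (_ , a) b → a , b}
          (⟿-weaken {eA = eB} (⟿-newest {eA = eA}) ⟿-∙ ⟿-newest {eA = eB})))
    where
    product : ∀ {A B : Set} (l : List A) (m : List B) → concatMap (λ a → map (a ,_) m) l ≡ cartesianProduct l m
    product []      m = refl
    product (a ∷ l) m = cong (map (a ,_) m ++_) (product l m)

size-filterᵇ : {A : Set} (e : A → Tree) (p : A → Bool) (xs : List A) →
               size (encodeList e (filterᵇ p xs)) ≤ size (encodeList e xs)
size-filterᵇ e p []       = ≤-refl
size-filterᵇ e p (x ∷ xs) with p x
... | true  = s≤s (+-monoʳ-≤ (size (e x)) (size-filterᵇ e p xs))
... | false = m≤n⇒m≤1+n (m≤n⇒m≤o+n (size (e x)) (size-filterᵇ e p xs))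

module _ {I : Set} {x : I → Tree} {G : I → Graph} where

  ⟿-adj : {u v : ∀ i → Vertex (G i)} → x ⟿ encodeGraph ∘ G →
    x ⟿ (λ i → encodeFin (u i)) → x ⟿ (λ i → encodeFin (v i)) →
    x ⟿ (λ i → encodeBool (adj (G i) (u i) (v i)))
  ⟿-adj {u} {v} g f h = ⟿-resp (λ i → cong encodeBool (entry (G i) (u i) (v i)))
    (⟿-lookup {eA = encodeBool} {xs = λ i → lookup (matrix (G i)) (u i)}
      (⟿-lookup {eA = encodeVec encodeBool} {xs = λ i → matrix (G i)} g f) h)
    where
    matrix : ∀ G → Vec (Vec Bool (order G)) (order G)
    matrix G = tabulate λ u → tabulate λ v → adj G u v
    entry : ∀ G u v → lookup (lookup (matrix G) u) v ≡ adj G u v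
    entry G u v = trans (cong (λ row → lookup row v) (lookup∘tabulate (λ u → tabulate (adj G u)) u))
                        (lookup∘tabulate (adj G u) v)

  ⟿-vertices : x ⟿ encodeGraph ∘ G → x ⟿ (λ i → encodeVertices {G i} (allFin (order (G i))))
  ⟿-vertices g = ⟿-allFin {eA = encodeVec encodeBool}
    {xs = λ i → tabulate λ u → tabulate λ v → adj (G i) u v} g

  ⟿-sameVertex : {u v : ∀ i → Vertex (G i)} →
    x ⟿ (λ i → encodeFin (u i)) → x ⟿ (λ i → encodeFin (v i)) →
    x ⟿ (λ i → encodeBool (sameVertex (G i) (u i) (v i)))
  ⟿-sameVertex {u} {v} = ⟿-≡ᵇ {m = λ i → toℕ (u i)} {λ i → toℕ (v i)}

  module _ {p q : ∀ i → Literal (G i)}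
           (f : x ⟿ (λ i → encodeLiteral {G i} (p i))) (g : x ⟿ (λ i → encodeLiteral {G i} (q i))) where

    ⟿-sameLiteral : x ⟿ (λ i → encodeBool (sameLiteral (G i) (p i) (q i)))
    ⟿-sameLiteral = ⟿-sameVertex {proj₁ ∘ p} {proj₁ ∘ q} (f ⟿-⨾ ⟿-left) (g ⟿-⨾ ⟿-left)
      ⟿-∧ ⟿-binary same (f ⟿-⨾ ⟿-right) (g ⟿-⨾ ⟿-right)

    ⟿-compatible : x ⟿ encodeGraph ∘ G → x ⟿ (λ i → encodeBool (compatible (G i) (p i) (q i)))
    ⟿-compatible graph =
      (⟿-not (⟿-sameVertex {proj₁ ∘ p} {proj₁ ∘ q} (f ⟿-⨾ ⟿-left) (g ⟿-⨾ ⟿-left))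
        ⟿-∨ ⟿-binary same (f ⟿-⨾ ⟿-right) (g ⟿-⨾ ⟿-right))
      ⟿-∧
      (⟿-not (⟿-adj {proj₁ ∘ p} {proj₁ ∘ q} graph (f ⟿-⨾ ⟿-left) (g ⟿-⨾ ⟿-left))
        ⟿-∨ ⟿-binary touch (f ⟿-⨾ ⟿-right) (g ⟿-⨾ ⟿-right))

⟿-permits : {I : Set} {x : I → Tree} {G : I → Graph} {M : ∀ i → Constraints (G i)}
  {p q : ∀ i → Literal (G i)} →
  x ⟿ (λ i → encodeConstraints {G i} (M i)) →
  x ⟿ (λ i → encodeLiteral {G i} (p i)) → x ⟿ (λ i → encodeLiteral {G i} (q i)) →
  x ⟿ (λ i → encodeBool (permits (G i) (M i) (p i) (q i)))
⟿-permits {G = G} {M} {p} {q} m f g = ⟿-any {eA = pair} m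
  (⟿-sameLiteral {G = G ∘ proj₁} {p = λ (i , _) → p i} {q = λ (_ , a) → proj₁ a}
     (⟿-weaken {eA = pair} f) (⟿-newest {eA = pair} ⟿-⨾ ⟿-left)
   ⟿-∧ ⟿-sameLiteral {G = G ∘ proj₁} {p = λ (i , _) → q i} {q = λ (_ , a) → proj₂ a}
     (⟿-weaken {eA = pair} g) (⟿-newest {eA = pair} ⟿-⨾ ⟿-right))
  where
  pair : ∀ {i} → Literal (G i) × Literal (G i) → Tree
  pair {i} = encodePair (encodeLiteral {G i}) (encodeLiteral {G i})

⟿-supports : {I : Set} {x : I → Tree} {G : I → Graph} {M : ∀ i → Constraints (G i)}
  {r p : ∀ i → Literal (G i)} →
  x ⟿ (λ i → encodeConstraints {G i} (M i)) →
  x ⟿ (λ i → encodeLiteral {G i} (r i)) → x ⟿ (λ i → encodeLiteral {G i} (p i)) →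
  x ⟿ (λ i → encodeBool (supports (G i) (M i) (r i) (p i)))
⟿-supports {G = G} {M} {r} {p} m f g =
  ⟿-permits {G = G} {M} {r} {r} m f f ⟿-∧ ⟿-permits {G = G} {M} {p} {r} m g f
    ⟿-∧ ⟿-permits {G = G} {M} {r} {p} m f g

⟿-eliminate : {I : Set} {x : I → Tree} {G : I → Graph} {M : ∀ i → Constraints (G i)}
  {v : ∀ i → Vertex (G i)} →
  x ⟿ (λ i → encodeConstraints {G i} (M i)) → x ⟿ (λ i → encodeFin (v i)) →
  x ⟿ (λ i → encodeConstraints {G i} (eliminate (G i) (M i) (v i)))
⟿-eliminate {I} {x} {G} {M} {v} m f = ⟿-filter {eA = pair} m
  (⟿-any {eA = encodeColour} (⟿-constant (encodeList encodeColour colours))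
    (⟿-supports {G = λ ((i , _) , _) → G i} {λ ((i , _) , _) → M i}
       {λ ((i , _) , z) → v i , z} {λ ((_ , pq) , _) → proj₁ pq}
       (weaken₂ m) r (pq ⟿-⨾ ⟿-left)
     ⟿-∧ ⟿-supports {G = λ ((i , _) , _) → G i} {λ ((i , _) , _) → M i}
       {λ ((i , _) , z) → v i , z} {λ ((_ , pq) , _) → proj₂ pq}
       (weaken₂ m) r (pq ⟿-⨾ ⟿-right)))
  where
  pair : ∀ {i} → Literal (G i) × Literal (G i) → Tree
  pair {i} = encodePair (encodeLiteral {G i}) (encodeLiteral {G i})
  x₂ : Σ (Σ I λ i → Literal (G i) × Literal (G i)) (λ _ → Colour) → Tree
  x₂ ((i , pq) , z) = (x i ∙ pair {i} pq) ∙ encodeColour z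
  weaken₂ : {y : I → Tree} → x ⟿ y → x₂ ⟿ (λ ((i , _) , _) → y i)
  weaken₂ h = ⟿-weaken {eA = encodeColour} (⟿-weaken {eA = pair} h)
  pq : x₂ ⟿ (λ ((i , pq) , _) → pair {i} pq)
  pq = ⟿-weaken {eA = encodeColour} (⟿-newest {eA = pair})
  r : x₂ ⟿ (λ ((i , _) , z) → encodeLiteral {G i} (v i , z))
  r = weaken₂ f ⟿-∙ ⟿-newest {eA = encodeColour}

⟿-eliminateAll : {I : Set} {x : I → Tree} {G : I → Graph} {M : ∀ i → Constraints (G i)}
  {vs : ∀ i → List (Vertex (G i))} →
  x ⟿ (λ i → encodeConstraints {G i} (M i)) → x ⟿ (λ i → encodeVertices {G i} (vs i)) →
  x ⟿ (λ i → encodeConstraints {G i} (eliminateAll (G i) (M i) (vs i)))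
⟿-eliminateAll {I} {x} {G} {M} {vs} m f =
  ⟿-foldl {eA = encodeFin} {eS = λ {i} → encodeConstraints {G i}}
    {step = λ i → eliminate (G i)} f m
    (⟿-eliminate {G = λ (i , _) → G i} {λ (_ , _ , M) → M} {λ (_ , v , _) → v}
       (⟿-right ⟿-⨾ ⟿-right) (⟿-right ⟿-⨾ ⟿-left))
    (con 0) λ i v M → ≤-trans (size-filterᵇ _ (survives (G i) M v) M) (m≤m+n _ 0)

-- Data are given by programs that extract them from the current input, not by fixed positions, so
-- the same procedures can be used under any number of binders.
record Environment {I : Set} (x : I → Tree) (G : I → Graph) (D : ∀ i → List (Vertex (G i)))
                   (pins : ∀ i → List (Literal (G i))) : Set where
  field
    graph⟿      : x ⟿ encodeGraph ∘ G
    dominators⟿ : x ⟿ (λ i → encodeVertices {G i} (D i))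
    pins⟿       : x ⟿ (λ i → encodeLiterals {G i} (pins i))

open Environment

weaken-environment : {I : Set} {x : I → Tree} {A : I → Set} {eA : ∀ {i} → A i → Tree}
  {G : I → Graph} {D : ∀ i → List (Vertex (G i))} {pins : ∀ i → List (Literal (G i))} →
  Environment x G D pins →
  Environment {Σ I A} (λ (i , a) → x i ∙ eA a) (G ∘ proj₁) (D ∘ proj₁) (pins ∘ proj₁)
weaken-environment {eA = eA} E = record
  { graph⟿      = ⟿-weaken {eA = eA} (graph⟿ E)
  ; dominators⟿ = ⟿-weaken {eA = eA} (dominators⟿ E)
  ; pins⟿       = ⟿-weaken {eA = eA} (pins⟿ E) }

module _ {I : Set} {x : I → Tree} {G : I → Graph} {D : ∀ i → List (Vertex (G i))}
         {pins : ∀ i → List (Literal (G i))} (E : Environment x G D pins) where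

  ⟿-literals : x ⟿ (λ i → encodeLiterals {G i} (literals (G i) (D i)))
  ⟿-literals = ⟿-cartesianProduct {eA = encodeFin} {eB = encodeColour} (⟿-vertices {G = G} (graph⟿ E))
    (⟿-constant (encodeList encodeColour colours))

  ⟿-admissible : {p : ∀ i → Literal (G i)} → x ⟿ (λ i → encodeLiteral {G i} (p i)) →
    x ⟿ (λ i → encodeBool (admissible (G i) (D i) (pins i) (p i)))
  ⟿-admissible {p} f =
    ⟿-all {eA = literal} (pins⟿ E)
      (⟿-compatible {G = G ∘ proj₁} {p ∘ proj₁} {proj₂} (⟿-weaken {eA = literal} f) (⟿-newest {eA = literal})
        (⟿-weaken {eA = literal} (graph⟿ E)))
    ⟿-∧
    (⟿-not (⟿-any {eA = encodeFin} (dominators⟿ E)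
       (⟿-sameVertex {G = G ∘ proj₁} {proj₁ ∘ p ∘ proj₁} {proj₂} (⟿-weaken {eA = encodeFin} (f ⟿-⨾ ⟿-left))
         (⟿-newest {eA = encodeFin})))
     ⟿-∨
     ⟿-not (⟿-case {z = proj₂ ∘ p} {h = λ z _ → encodeBool (isCut z)} (f ⟿-⨾ ⟿-right)
       λ z → ⟿-constant (encodeBool (isCut z)))
     ⟿-∨
     ⟿-any {eA = literal} (pins⟿ E)
       (⟿-sameLiteral {G = G ∘ proj₁} {p ∘ proj₁} {proj₂}
         (⟿-weaken {eA = literal} f) (⟿-newest {eA = literal})))
    where
    literal : ∀ {i} → Literal (G i) → Tree
    literal {i} = encodeLiteral {G i}

⟿-arcConsistent : {I : Set} {x : I → Tree} {G : I → Graph} {D : ∀ i → List (Vertex (G i))}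
  {pins : ∀ i → List (Literal (G i))} (E : Environment x G D pins) {p : ∀ i → Literal (G i)} →
  x ⟿ (λ i → encodeLiteral {G i} (p i)) →
  x ⟿ (λ i → encodeBool (arcConsistent (G i) (D i) (pins i) (p i)))
⟿-arcConsistent {I} {x} {G} {D} {pins} E {p} f =
  ⟿-admissible E {p} f
  ⟿-∧
  ⟿-all {eA = encodeFin} (dominators⟿ E)
    (⟿-any {eA = encodeColour} (⟿-constant (encodeList encodeColour colours))
      (⟿-admissible E₂ {q} q⟿
       ⟿-∧
       ⟿-compatible {G = λ ((i , _) , _) → G i} {q} {λ ((i , _) , _) → p i} q⟿
         (⟿-weaken {eA = encodeColour} (⟿-weaken {eA = encodeFin} f)) (graph⟿ E₂)))
  where
  E₂ = weaken-environment {eA = encodeColour} (weaken-environment {eA = encodeFin} E)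
  q : (j : Σ (Σ I λ i → Vertex (G i)) (λ _ → Colour)) → Literal (G (proj₁ (proj₁ j)))
  q ((_ , u) , w) = u , w
  q⟿ : (λ ((i , u) , w) → (x i ∙ encodeFin u) ∙ encodeColour w) ⟿
       (λ j → encodeLiteral {G (proj₁ (proj₁ j))} (q j))
  q⟿ = ⟿-weaken {eA = encodeColour} (⟿-newest {eA = encodeFin}) ⟿-∙ ⟿-newest {eA = encodeColour}

module _ {I : Set} {x : I → Tree} {G : I → Graph} {D : ∀ i → List (Vertex (G i))}
         {pins : ∀ i → List (Literal (G i))} (E : Environment x G D pins) where

  private
    literal : ∀ {i} → Literal (G i) → Tree
    literal {i} = encodeLiteral {G i}

  ⟿-twoColours : x ⟿ (λ i → encodeBool (twoColours (G i) (D i) (pins i)))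
  ⟿-twoColours = ⟿-all {eA = encodeFin} (⟿-vertices {G = G} (graph⟿ E))
    (⟿-any {eA = encodeColour} (⟿-constant (encodeList encodeColour colours))
      (⟿-not (⟿-arcConsistent
        (weaken-environment {eA = encodeColour} (weaken-environment {eA = encodeFin} E))
        {λ ((_ , v) , z) → v , z}
        (⟿-weaken {eA = encodeColour} (⟿-newest {eA = encodeFin}) ⟿-∙ ⟿-newest {eA = encodeColour}))))

  ⟿-constraints : x ⟿ (λ i → encodeConstraints {G i} (constraints (G i) (D i) (pins i)))
  ⟿-constraints = ⟿-filter {eA = pair} (⟿-cartesianProduct {eA = literal} {eB = literal} lits lits)
    (⟿-compatible {G = G ∘ proj₁} {proj₁ ∘ proj₂} {proj₂ ∘ proj₂}
      (⟿-newest {eA = pair} ⟿-⨾ ⟿-left) (⟿-newest {eA = pair} ⟿-⨾ ⟿-right)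
      (⟿-weaken {eA = pair} (graph⟿ E)))
    where
    pair : ∀ {i} → Literal (G i) × Literal (G i) → Tree
    pair {i} = encodePair (encodeLiteral {G i}) (encodeLiteral {G i})
    lits : x ⟿ (λ i → encodeLiterals {G i} (filterᵇ (arcConsistent (G i) (D i) (pins i)) (literals (G i) (D i))))
    lits = ⟿-filter {eA = literal} (⟿-literals E)
      (⟿-arcConsistent (weaken-environment {eA = literal} E) {proj₂} (⟿-newest {eA = literal}))

  ⟿-verify : x ⟿ (λ i → encodeBool (verify (G i) (D i) (pins i)))
  ⟿-verify = ⟿-twoColours ⟿-∧
    ⟿-any {eA = λ {i} → encodePair (encodeLiteral {G i}) (encodeLiteral {G i})}
      (⟿-eliminateAll {G = G} ⟿-constraints (⟿-vertices {G = G} (graph⟿ E)))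
      (⟿-constant (encodeBool true))

-- The recursion on `m` takes place while the program is built and yields `m` nested loops over the
-- literals; the polynomial bounds depend on `m`, which is a constant.
⟿-guess : ∀ m {I : Set} {x : I → Tree} {G : I → Graph} {D : ∀ i → List (Vertex (G i))}
  {pins : ∀ i → List (Literal (G i))} → Environment x G D pins →
  x ⟿ (λ i → encodeBool (guess (G i) (D i) m (pins i)))
⟿-guess zero    E = ⟿-verify E
⟿-guess (suc m) {G = G} E = ⟿-verify E ⟿-∨ ⟿-any {eA = literal} (⟿-literals E)
  (⟿-guess m record
    { graph⟿ = graph⟿ E′ ; dominators⟿ = dominators⟿ E′ ; pins⟿ = ⟿-newest {eA = literal} ⟿-∙ pins⟿ E′ })
  where
  literal : ∀ {i} → Literal (G i) → Tree
  literal {i} = encodeLiteral {G i}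
  E′ = weaken-environment {eA = literal} E

⟿-check : ∀ m {I : Set} {x : I → Tree} {G : I → Graph} {D : ∀ i → List (Vertex (G i))}
  {pins : ∀ i → List (Literal (G i))} → Environment x G D pins →
  x ⟿ (λ i → encodeBool (check (G i) (D i) m (pins i)))
⟿-check m {I} {x} {G} E = ⟿-any {eA = encodeFin} (⟿-vertices {G = G} (graph⟿ E))
  (⟿-any {eA = encodeFin} (⟿-vertices {G = G ∘ proj₁} (graph⟿ E₁))
    (⟿-guess m record
      { graph⟿      = graph⟿ E₂
      ; dominators⟿ = dominators⟿ E₂
      ; pins⟿       = (⟿-weaken {eA = encodeFin} (⟿-newest {eA = encodeFin}) ⟿-∙ ⟿-constant (encodeColour side₁))
                      ⟿-∙ (⟿-newest {eA = encodeFin} ⟿-∙ ⟿-constant (encodeColour side₂))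
                      ⟿-∙ pins⟿ E₂ }))
  where
  E₁ = weaken-environment {eA = encodeFin} E
  E₂ = weaken-environment {eA = encodeFin} E₁

-- The branching on the colours of the deletion set

module Branching (m : ℕ) where

  encodeParameters : (G : Graph) → List (Vertex G) → Tree
  encodeParameters G D = encodeGraph G ∙ encodeVertices {G} D

  encodeEntry : (G : Graph) → List (Literal G) → List (Vertex G) → Tree
  encodeEntry G pins xs = encodeLiterals {G} pins ∙ encodeVertices {G} xs

  state : Tree → Tree → Bool → Tree
  state params stack found = params ∙ (stack ∙ encodeBool found)

  -- The stack is not empty; its top entry consists of pins and xs.
  record Situation : Set where
    constructor situation
    field
      G     : Graph
      D     : List (Vertex G)
      pins  : List (Literal G)
      xs    : List (Vertex G)
      rest  : Tree
      found : Bool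

  before : Situation → Tree
  before (situation G D pins xs rest found) =
    state (encodeParameters G D) (encodeEntry G pins xs ∙ rest) found

  after : Situation → Tree
  after (situation G D pins [] rest found) =
    state (encodeParameters G D) rest (found ∨ check G D m pins)
  after (situation G D pins (x ∷ xs) rest found) =
    state (encodeParameters G D) (entry side₁ ∙ entry side₂ ∙ entry cut ∙ rest) found
    where
    entry : Colour → Tree
    entry z = encodeEntry G ((x , z) ∷ pins) xs

  abstract
    step : before ⟿ after
    step = ⟿-resp cond-step
      (⟿-cond {y = branchTree} {leafTree} xs
        (⟿-left ⟿-∙ (entry side₁ ⟿-∙ entry side₂ ⟿-∙ entry cut ⟿-∙ rest) ⟿-∙ (⟿-right ⟿-⨾ ⟿-right))
        (⟿-left ⟿-∙ rest ⟿-∙ (_⟿-∨_ {b = Situation.found} (⟿-right ⟿-⨾ ⟿-right) (⟿-check m {G = G} {Situation.D} {Situation.pins} record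
          { graph⟿ = ⟿-left ⟿-⨾ ⟿-left ; dominators⟿ = ⟿-left ⟿-⨾ ⟿-right ; pins⟿ = pins }))))
      where
      open Situation using (G)
      pins : before ⟿ (λ j → encodeLiterals {G j} (Situation.pins j))
      pins = ⟿-right ⟿-⨾ ⟿-left ⟿-⨾ ⟿-left ⟿-⨾ ⟿-left
      xs : before ⟿ (λ j → encodeVertices {G j} (Situation.xs j))
      xs = ⟿-right ⟿-⨾ ⟿-left ⟿-⨾ ⟿-left ⟿-⨾ ⟿-right
      rest : before ⟿ Situation.rest
      rest = ⟿-right ⟿-⨾ ⟿-left ⟿-⨾ ⟿-right
      -- `left` and `right` make this tree meaningful for empty `xs` too, because `⟿-cond` asks for
      -- both branches at every index.
      entryTree : Colour → Situation → Tree
      entryTree z j = ((left (encodeVertices {G j} (Situation.xs j)) ∙ encodeColour z)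
                       ∙ encodeLiterals {G j} (Situation.pins j))
                      ∙ right (encodeVertices {G j} (Situation.xs j))
      entry : ∀ z → before ⟿ entryTree z
      entry z = (((xs ⟿-⨾ ⟿-left) ⟿-∙ ⟿-constant (encodeColour z)) ⟿-∙ pins) ⟿-∙ (xs ⟿-⨾ ⟿-right)
      leafTree branchTree : Situation → Tree
      leafTree j = left (before j) ∙ Situation.rest j ∙
        encodeBool (Situation.found j ∨ check (G j) (Situation.D j) m (Situation.pins j))
      branchTree j = left (before j) ∙
        (entryTree side₁ j ∙ entryTree side₂ j ∙ entryTree cut j ∙ Situation.rest j) ∙
        encodeBool (Situation.found j)
      cond-step : ∀ j → cond (encodeVertices {G j} (Situation.xs j)) (branchTree j) (leafTree j) ≡ after j
      cond-step (situation G D pins []       rest found) = refl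
      cond-step (situation G D pins (x ∷ xs) rest found) = refl

  test : Program
  test = tl ⨾ hd

  -- The size of the complete ternary tree of depth `r`; each of its nodes, inner or leaf, costs one
  -- pass of the loop.
  nodes : ℕ → ℕ
  nodes zero    = 1
  nodes (suc r) = suc (nodes r + (nodes r + nodes r))

  -- The successor strengthens the bound so that the induction closes: the extra 1 of every level is
  -- absorbed into it.
  nodes≤ : ∀ r → suc (nodes r) ≤ 2 * 3 ^ r
  nodes≤ zero    = ≤-refl
  nodes≤ (suc r) = begin
    2 + (nodes r + (nodes r + nodes r))          ≤⟨ n≤1+n _ ⟩
    3 + (nodes r + (nodes r + nodes r))          ≡⟨ regroup (nodes r) ⟩
    3 * suc (nodes r)                            ≤⟨ *-monoʳ-≤ 3 (nodes≤ r) ⟩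
    3 * (2 * 3 ^ r)                              ≡⟨ *-assoc 3 2 (3 ^ r) ⟨
    6 * 3 ^ r                                    ≡⟨ *-assoc 2 3 (3 ^ r) ⟩
    2 * (3 * 3 ^ r)                              ∎
    where
    open ≤-Reasoning
    regroup : ∀ n → 3 + (n + (n + n)) ≡ 3 * suc n
    regroup = solve-∀

  module _ (G : Graph) (D : List (Vertex G)) (E S : ℕ) where

    -- With `r` vertices left to colour, the stack above `rest` holds at most two waiting siblings
    -- for each level and the entry being processed, each of size at most `E` plus a cell.
    room : ℕ → ℕ
    room r = suc (2 * r) * suc E

    W : ℕ
    -- 3 is the cost of `test`; 5 accounts for the two pairs of the state and a flag of size at most
    -- 3.
    W = 3 + ⟦ time step ⟧ (5 + (size (encodeParameters G D) + S))

    private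
      params = encodeParameters G D

    size-state : ∀ stack found → size stack ≤ S → size (state params stack found) ≤ 5 + (size params + S)
    size-state stack found stack≤ = begin
      suc (size params + suc (size stack + size (encodeBool found)))
        ≤⟨ s≤s (+-monoʳ-≤ (size params) (s≤s (+-mono-≤ stack≤ (size-Bool found)))) ⟩
      suc (size params + suc (S + 3))  ≡⟨ regroup (size params) S ⟩
      5 + (size params + S)            ∎
      where
      open ≤-Reasoning
      regroup : ∀ p s → suc (p + suc (s + 3)) ≡ 5 + (p + s)
      regroup = solve-∀

    -- `6 * length xs` is reserved for the colours still to be recorded: each adds a pair cell and a
    -- colour of size at most 5.
    Budget : List (Literal G) → List (Vertex G) → Tree → Set
    Budget pins xs rest = size (encodeEntry G pins xs) + 6 * length xs ≤ E × size rest + room (length xs) ≤ S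

    visit : ∀ pins xs rest found → Budget pins xs rest →
      let j = situation G D pins xs rest found in
      Passes test (program step) W 1 (before j) (after j)
    visit pins xs rest found (entry≤ , room≤) =
      let t , ↓ , t≤ = run step (situation G D pins xs rest found) in
      pass (seq tl hd) ↓ (+-monoʳ-≤ 3 (≤-trans t≤ (⟦⟧-mono (time step) (size-state (encodeEntry G pins xs ∙ rest) found (begin
        suc (size (encodeEntry G pins xs) + size rest)
          ≤⟨ s≤s (+-monoˡ-≤ (size rest) (≤-trans (m≤m+n _ (6 * length xs)) entry≤)) ⟩
        suc E + size rest               ≡⟨ +-comm (suc E) (size rest) ⟩
        size rest + suc E               ≤⟨ +-monoʳ-≤ (size rest) (m≤m+n (suc E) (2 * length xs * suc E)) ⟩
        size rest + room (length xs)    ≤⟨ room≤ ⟩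
        S                               ∎))))) done
      where open ≤-Reasoning

    size-Colour : ∀ z → size (encodeColour z) ≤ 5
    size-Colour cut   = s≤s z≤n
    size-Colour side₁ = s≤s (s≤s (s≤s z≤n))
    size-Colour side₂ = ≤-refl

    -- An entry grows by at most 6 when the colour of x is recorded.
    size-child : ∀ pins x xs z →
      size (encodeEntry G ((x , z) ∷ pins) xs) + 6 * length xs
      ≤ size (encodeEntry G pins (x ∷ xs)) + 6 * length (x ∷ xs)
    size-child pins x xs z = begin
      suc (suc (suc (X + Z) + P) + L) + 6 * length xs
        ≤⟨ +-monoˡ-≤ _ (s≤s (+-monoˡ-≤ L (s≤s (+-monoˡ-≤ P (s≤s (+-monoʳ-≤ X (size-Colour z))))))) ⟩
      suc (suc (suc (X + 5) + P) + L) + 6 * length xs  ≡⟨ regroup X P L (length xs) ⟩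
      suc (P + suc (X + L)) + 6 * suc (length xs)      ∎
      where
      open ≤-Reasoning
      X = size (encodeFin x)
      Z = size (encodeColour z)
      P = size (encodeLiterals {G} pins)
      L = size (encodeVertices {G} xs)
      regroup : ∀ x p l n → suc (suc (suc (x + 5) + p) + l) + 6 * n ≡ suc (p + suc (x + l)) + 6 * suc n
      regroup = solve-∀

    -- A subtree of the search is processed by consecutive passes that end with exactly `rest` on
    -- the stack, so the runs of the three children can be concatenated. The bounds `E` and `S` stay
    -- fixed throughout.
    explore : ∀ pins xs rest found → Budget pins xs rest →
      Passes test (program step) W (nodes (length xs))
        (state params (encodeEntry G pins xs ∙ rest) found)
        (state params rest (found ∨ branch G D m pins xs))
    explore pins []       rest found budget = visit pins [] rest found budget
    explore pins (x ∷ xs) rest found budget@(entry≤ , room≤) =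
      Passes-trans (visit pins (x ∷ xs) rest found budget)
        (subst (λ b → Passes test (program step) W (n + (n + n)) (after (situation G D pins (x ∷ xs) rest found)) (state params rest b))
          -- The flag collects the three results from the left, whereas `any` associates to the
          -- right and ends in `false`.
          (∨-flatten found (b side₁) (b side₂) (b cut))
          (Passes-trans (explore (p side₁) xs rest₁ found (child≤ side₁ , room₁))
          (Passes-trans (explore (p side₂) xs rest₂ _ (child≤ side₂ , room₂))
                        (explore (p cut) xs rest _ (child≤ cut , room₃)))))
      where
      open ≤-Reasoning
      n = nodes (length xs)
      p : Colour → List (Literal G)
      p z = (x , z) ∷ pins
      b : Colour → Bool
      b z = branch G D m (p z) xs
      rest₂ = encodeEntry G (p cut) xs ∙ rest
      rest₁ = encodeEntry G (p side₂) xs ∙ rest₂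
      child≤ : ∀ z → size (encodeEntry G (p z) xs) + 6 * length xs ≤ E
      child≤ z = ≤-trans (size-child pins x xs z) entry≤
      entry≤E : ∀ z → size (encodeEntry G (p z) xs) ≤ E
      entry≤E z = ≤-trans (m≤m+n _ (6 * length xs)) (child≤ z)
      room-suc : ∀ r → suc E + (suc E + room r) ≡ room (suc r)
      room-suc r = trans (sym (+-assoc (suc E) (suc E) (room r)))
        (trans (cong (_+ room r) (sym (cong (suc E +_) (+-identityʳ (suc E)))))
          (trans (sym (*-distribʳ-+ (suc E) 2 (suc (2 * r)))) (cong (λ k → suc k * suc E)
            (trans (+-suc 1 (2 * r)) (sym (*-suc 2 r))))))
      room₁ : size rest₁ + room (length xs) ≤ S
      room₁ = begin
        suc (size (encodeEntry G (p side₂) xs) + suc (size (encodeEntry G (p cut) xs) + size rest))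
          + room (length xs)
          ≤⟨ +-monoˡ-≤ (room (length xs)) (s≤s (+-mono-≤ (entry≤E side₂) (s≤s (+-monoˡ-≤ (size rest) (entry≤E cut))))) ⟩
        suc E + (suc E + size rest) + room (length xs)  ≡⟨ regroup (suc E) (size rest) (room (length xs)) ⟩
        size rest + (suc E + (suc E + room (length xs))) ≡⟨ cong (size rest +_) (room-suc (length xs)) ⟩
        size rest + room (suc (length xs))               ≤⟨ room≤ ⟩
        S                                                ∎
        where
        regroup : ∀ e r s → e + (e + r) + s ≡ r + (e + (e + s))
        regroup = solve-∀
      room₂ : size rest₂ + room (length xs) ≤ S
      room₂ = ≤-trans (+-monoˡ-≤ (room (length xs)) (size-right rest₁)) room₁
      room₃ : size rest + room (length xs) ≤ S
      room₃ = ≤-trans (+-monoˡ-≤ (room (length xs)) (size-right rest₂)) room₂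
      ∨-flatten : ∀ a b c d → ((a ∨ b) ∨ c) ∨ d ≡ a ∨ (b ∨ (c ∨ (d ∨ false)))
      ∨-flatten false false c d = cong (c ∨_) (sym (∨-identityʳ d))
      ∨-flatten false true  c d = refl
      ∨-flatten true  b     c d = refl

-- Sizes of encodings

size-encodeVec : ∀ {A : Set} {n} (e : A → Tree) {B} → (∀ a → size (e a) ≤ B) →
                 (xs : Vec A n) → size (encodeVec e xs) ≤ 1 + n * suc B
size-encodeVec e e≤ []       = ≤-refl
size-encodeVec {n = suc n} e {B} e≤ (x ∷ xs) = s≤s (begin
  size (e x) + size (encodeVec e xs)   ≤⟨ +-mono-≤ (e≤ x) (size-encodeVec e e≤ xs) ⟩
  B + suc (n * suc B)                  ≡⟨ +-suc B _ ⟩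
  suc B + n * suc B                    ∎)
  where open ≤-Reasoning

subsetSize graphSize : Polynomial
subsetSize = con 1 ⊕ var ⊗ con 4
graphSize  = con 1 ⊕ var ⊗ (con 1 ⊕ subsetSize)

size-encodeSubset : ∀ {n} (S : Subset n) → size (encodeSubset S) ≤ ⟦ subsetSize ⟧ n
size-encodeSubset = size-encodeVec encodeBool size-Bool

size-encodeGraph : ∀ G → size (encodeGraph G) ≤ ⟦ graphSize ⟧ (order G)
size-encodeGraph G = size-encodeVec (encodeVec encodeBool) size-encodeSubset _

-- Vertex sets and induced subgraphs

filterᵇ-map : ∀ {A B : Set} (p : B → Bool) (f : A → B) xs → filterᵇ p (map f xs) ≡ map f (filterᵇ (p ∘ f) xs)
filterᵇ-map p f []       = refl
filterᵇ-map p f (x ∷ xs) with p (f x)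
... | true  = cong (f x ∷_) (filterᵇ-map p f xs)
... | false = filterᵇ-map p f xs

elements-∷ : ∀ {n} b (S : Subset n) →
             filterᵇ (lookup (b Vec.∷ S)) (List.tabulate suc) ≡ map suc (elements S)
elements-∷ b S = trans (cong (filterᵇ (lookup (b Vec.∷ S))) (sym (map-tabulate id suc)))
                       (filterᵇ-map (lookup (b Vec.∷ S)) suc (allFin _))

-- The renumbering in an induced subgraph thus becomes indexing into a list that a program can
-- compute by filtering.
elements-nth : ∀ {n} (S : Subset n) → elements S ≡ List.tabulate (nth S)
elements-nth []            = refl
elements-nth (inside ∷ S)  = cong (zero ∷_)
  (trans (elements-∷ inside S) (trans (cong (map suc) (elements-nth S)) (map-tabulate (nth S) suc)))
elements-nth (outside ∷ S) =
  trans (elements-∷ outside S) (trans (cong (map suc) (elements-nth S)) (map-tabulate (nth S) suc))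

length-elements : ∀ {n} (S : Subset n) → length (elements S) ≡ ∣ S ∣
length-elements S = trans (cong length (elements-nth S)) (length-tabulate (nth S))

module _ {I : Set} {x : I → Tree} {n : I → ℕ} {S : ∀ i → Subset (n i)} (f : x ⟿ (λ i → encodeSubset (S i))) where

  ⟿-∁ : x ⟿ (λ i → encodeSubset (∁ (S i)))
  ⟿-∁ = ⟿-resp (λ i → trans (cong (encodeList encodeBool) (sym (toList-map not (S i))))
                             (sym (encodeVec-toList encodeBool (∁ (S i)))))
    (⟿-map {eA = encodeBool} (⟿-resp (λ i → encodeVec-toList encodeBool (S i)) f) {eB = encodeBool}
      {g = λ _ → not} (⟿-not (⟿-newest {eA = encodeBool})))

  ⟿-elements : x ⟿ (λ i → encodeList encodeFin (elements (S i)))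
  ⟿-elements = ⟿-filter {eA = encodeFin} (⟿-allFin {eA = encodeBool} {xs = S} f)
    (⟿-lookup {eA = encodeBool} {xs = S ∘ proj₁} (⟿-weaken {eA = encodeFin} f) (⟿-newest {eA = encodeFin}))

⟿-nth : {I : Set} {x : I → Tree} {n : I → ℕ} {S : ∀ i → Subset (n i)} {j : ∀ i → Fin ∣ S i ∣} →
  x ⟿ (λ i → encodeSubset (S i)) → x ⟿ (λ i → encodeFin (j i)) → x ⟿ (λ i → encodeFin (nth (S i) (j i)))
⟿-nth {S = S} {j} f g = ⟿-resp (λ i → cong encodeFin (lookup∘tabulate (nth (S i)) (j i)))
  (⟿-lookup {eA = encodeFin} {xs = λ i → tabulate (nth (S i))} (⟿-resp listed (⟿-elements f)) g)
  where
  listed : ∀ i → encodeList encodeFin (elements (S i)) ≡ encodeVec encodeFin (tabulate (nth (S i)))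
  listed i = trans (cong (encodeList encodeFin) (trans (elements-nth (S i)) (sym (map-tabulate id (nth (S i))))))
                   (sym (encodeVec-tabulate encodeFin (nth (S i))))

⟿-induced : {I : Set} {x : I → Tree} {G : I → Graph} {S : ∀ i → VertexSet (G i)} →
  x ⟿ encodeGraph ∘ G → x ⟿ (λ i → encodeSubset (S i)) → x ⟿ (λ i → encodeGraph (G i [ S i ]))
⟿-induced {G = G} {S} f g = ⟿-resp (λ i → rows (G i) (S i))
  (⟿-map {eA = encodeFin} (⟿-elements g) {eB = encodeList encodeBool}
    {g = λ i u → map (adj (G i) u) (elements (S i))}
    (⟿-map {eA = encodeFin} (⟿-weaken {eA = encodeFin} (⟿-elements g)) {eB = encodeBool}
      {g = λ (i , u) → adj (G i) u}
      (⟿-adj {G = λ ((i , _) , _) → G i} {λ ((_ , u) , _) → u} {proj₂}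
        (⟿-weaken {eA = encodeFin} (⟿-weaken {eA = encodeFin} f))
        (⟿-weaken {eA = encodeFin} (⟿-newest {eA = encodeFin}))
        (⟿-newest {eA = encodeFin}))))
  where
  listed : ∀ {A : Set} (e : A → Tree) {n} (S : Subset n) (h : Fin n → A) →
           encodeList e (map h (elements S)) ≡ encodeVec e (tabulate (h ∘ nth S))
  listed e S h = trans (cong (encodeList e) (trans (cong (map h) (elements-nth S))
                   (trans (map-tabulate (nth S) h) (sym (map-tabulate id (h ∘ nth S))))))
                 (sym (encodeVec-tabulate e (h ∘ nth S)))
  rows : ∀ G S → encodeList (encodeList encodeBool) (map (λ u → map (adj G u) (elements S)) (elements S))
                 ≡ encodeGraph (G [ S ])
  rows G S = trans (encodeList-map (encodeList encodeBool) (λ u → map (adj G u) (elements S)) (elements S))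
    (trans (encodeList-cong (λ u → listed encodeBool S (adj G u)) (elements S))
      (trans (sym (encodeList-map (encodeVec encodeBool) (λ u → tabulate (adj G u ∘ nth S)) (elements S)))
        (listed (encodeVec encodeBool) S (λ u → tabulate (adj G u ∘ nth S)))))
    where
    encodeList-cong : ∀ {A : Set} {e e′ : A → Tree} → (∀ a → e a ≡ e′ a) →
                      ∀ xs → encodeList e xs ≡ encodeList e′ xs
    encodeList-cong eq []       = refl
    encodeList-cong eq (x ∷ xs) = cong₂ _∙_ (eq x) (encodeList-cong eq xs)

-- The algorithm

module Algorithm (c : ℕ) where

  open Branching (c + (c + c)) public

  record Input : Set where
    constructor input
    field
      G : Graph
      X : VertexSet G
      Y : VertexSet (G − X)

  deletion : Σ Graph VertexSet → Tree
  deletion (G , X) = encodeGraph G ∙ encodeSubset X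

  dominated : Input → Tree
  dominated (input G X Y) = deletion (G , X) ∙ encodeSubset Y

  initial final : Input → Tree
  initial (input G X Y) =
    state (encodeParameters G (dominators c G X Y)) (encodeEntry G [] (elements X) ∙ nil) false
  final (input G X Y) =
    state (encodeParameters G (dominators c G X Y)) nil (decision c G X Y)

  abstract
    delete : deletion ⟿ (λ (G , X) → deletion (G , X) ∙ encodeGraph (G − X))
    delete = ⟿-id ⟿-∙ ⟿-induced {G = proj₁} {S = λ (G , X) → ∁ X} ⟿-left (⟿-∁ {S = proj₂} ⟿-right)

    initialise : dominated ⟿ initial
    initialise = (graph ⟿-∙ ⟿-map {eA = encodeFin} (⟿-elements {S = Input.Y} ⟿-right) {eB = encodeFin}
        {g = λ i → nth (∁ (Input.X i))}
        (⟿-nth {S = λ (i , _) → ∁ (Input.X i)} {proj₂}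
          (⟿-weaken {eA = encodeFin} (⟿-∁ {S = Input.X} X)) (⟿-newest {eA = encodeFin})))
      ⟿-∙ ((⟿-nil ⟿-∙ ⟿-elements {S = Input.X} X) ⟿-∙ ⟿-nil) ⟿-∙ ⟿-nil
      where
      graph : dominated ⟿ encodeGraph ∘ Input.G
      graph = ⟿-left ⟿-⨾ ⟿-left
      X : dominated ⟿ (λ i → encodeSubset (Input.X i))
      X = ⟿-left ⟿-⨾ ⟿-right

  deletionSize dominatedSize initialSize entryBound stackBound passCost : Polynomial
  deletionSize  = con 1 ⊕ (graphSize ⊕ subsetSize)
  dominatedSize = con 1 ⊕ (deletionSize ⊕ subsetSize)
  initialSize   = outsize initialise ⊚ dominatedSize
  -- These bounds provide the budget at the root of the search: at most `n` vertices to colour, and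
  -- only `nil`, of size 1, below the first entry.
  entryBound    = initialSize ⊕ con 6 ⊗ var
  stackBound    = con 1 ⊕ (con 1 ⊕ con 2 ⊗ var) ⊗ (con 1 ⊕ entryBound)
  passCost      = con 3 ⊕ time step ⊚ (con 5 ⊕ (initialSize ⊕ stackBound))

  size-deletion : ∀ G X → size (deletion (G , X)) ≤ ⟦ deletionSize ⟧ (order G)
  size-deletion G X = s≤s (+-mono-≤ (size-encodeGraph G) (size-encodeSubset X))

  size-dominated : ∀ i → size (dominated i) ≤ ⟦ dominatedSize ⟧ (order (Input.G i))
  size-dominated (input G X Y) = s≤s (+-mono-≤ (size-deletion G X)
    (≤-trans (size-encodeSubset Y) (⟦⟧-mono subsetSize (∣p∣≤n (∁ X)))))

  size-initial : ∀ i → size (initial i) ≤ ⟦ initialSize ⟧ (order (Input.G i))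
  size-initial i = ≤-trans (outsize-≤ initialise i) (⟦⟧-mono (outsize initialise) (size-dominated i))

  Passes-weaken : ∀ {B P W W′ m x y} → W ≤ W′ → Passes B P W m x y → Passes B P W′ m x y
  Passes-weaken W≤ done              = done
  Passes-weaken W≤ (pass B↓ P↓ c≤ p) = pass B↓ P↓ (≤-trans c≤ W≤) (Passes-weaken W≤ p)

  search : ∀ i → let n = order (Input.G i) in
    Passes test (program step) (⟦ passCost ⟧ n) (nodes ∣ Input.X i ∣) (initial i) (final i)
  search i@(input G X Y) = Passes-weaken
    (+-monoʳ-≤ 3 (⟦⟧-mono (time step) (+-monoʳ-≤ 5 (+-monoˡ-≤ _ (≤-trans params≤ (size-initial i))))))
    (subst (λ k → Passes test (program step) (W G (dominators c G X Y) (⟦ entryBound ⟧ n) (⟦ stackBound ⟧ n))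
                    (nodes k) (initial i) (final i))
      (length-elements X)
      (explore G (dominators c G X Y) (⟦ entryBound ⟧ n) (⟦ stackBound ⟧ n) [] (elements X) nil false
        (+-mono-≤ (≤-trans entry≤ (size-initial i)) (*-monoʳ-≤ 6 length≤)
        , s≤s (*-monoˡ-≤ (suc (⟦ entryBound ⟧ n)) (s≤s (*-monoʳ-≤ 2 length≤))))))
    where
    n = order G
    length≤ : length (elements X) ≤ n
    length≤ = ≤-trans (≤-reflexive (length-elements X)) (∣p∣≤n X)
    params≤ : size (encodeParameters G (dominators c G X Y)) ≤ size (initial i)
    params≤ = size-left (initial i)
    entry≤ : size (encodeEntry G [] (elements X)) ≤ size (initial i)
    entry≤ = ≤-trans (size-left (left (right (initial i))))
      (≤-trans (size-left (right (initial i))) (size-right (initial i)))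

  -- The store is a single tree, so `cons` keeps what later commands need while `find` sees exactly
  -- the encoding of `G` and `dominate` exactly that of `G − X`.
  algorithm : Program → Program → Program
  algorithm find dominate =
    cons skip find ⨾ program delete ⨾ cons hd (tl ⨾ dominate) ⨾ program initialise ⨾
    (while test loop program step) ⨾ tl ⨾ tl

  overhead : Polynomial → Polynomial
  -- 18 collects the fixed steps of `algorithm`, including the last test of the loop.
  overhead p = (con 18 ⊕ (time delete ⊚ deletionSize ⊕ p ⊕ time initialise ⊚ dominatedSize))
    ⊕ con 2 ⊗ (con 1 ⊕ passCost)

  algorithm-run : ∀ {find dominate s t} i (p : Polynomial) → let open Input i; n = order G in
    find ⊢ encodeGraph G ⇓[ s ] encodeSubset X →
    dominate ⊢ encodeGraph (G − X) ⇓[ t ] encodeSubset Y → t ≤ ⟦ p ⟧ n →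
    ∃[ u ] (algorithm find dominate ⊢ encodeGraph G ⇓[ u ] encodeBool (decision c G X Y)
          × u ≤ s + 3 ^ ∣ X ∣ * ⟦ overhead p ⟧ n)
  algorithm-run {s = s} {t} i@(input G X Y) p find↓ dominate↓ t≤ =
    let a , delete↓ , a≤ = run delete (G , X)
        b , init↓ , b≤   = run initialise i
        w , while↓ , w≤  = Passes⇒while (search i) (seq tl hd)
    in _ , seq (cons skip find↓) (seq delete↓ (seq (cons hd (seq tl dominate↓))
             (seq init↓ (seq while↓ (seq tl tl))))) , (begin
      suc (2 + s + suc (a + suc (4 + t + suc (b + suc (w + 3)))))
        ≡⟨ regroup₁ s a t b w ⟩
      s + (14 + (a + t + b) + w)
        ≤⟨ +-monoʳ-≤ s (+-mono-≤ (+-monoʳ-≤ 14 (+-mono-≤ (+-mono-≤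
             (≤-trans a≤ (⟦⟧-mono (time delete) (size-deletion G X))) t≤)
             (≤-trans b≤ (⟦⟧-mono (time initialise) (size-dominated i)))))
             (≤-trans w≤ (+-monoˡ-≤ 4 (*-monoˡ-≤ (suc (⟦ passCost ⟧ n)) (<⇒≤ (nodes≤ ∣ X ∣)))))) ⟩
      s + (14 + R + (2 * K * suc (⟦ passCost ⟧ n) + 4))
        ≡⟨ cong (s +_) (regroup₂ R K (⟦ passCost ⟧ n)) ⟩
      s + (1 * (18 + R) + K * (2 * suc (⟦ passCost ⟧ n)))
        -- The preparation happens once; it is charged to the factor `3 ^ ∣ X ∣`, which is at least
        -- 1.
        ≤⟨ +-monoʳ-≤ s (+-monoˡ-≤ _ (*-monoˡ-≤ (18 + R) (m^n>0 3 ∣ X ∣))) ⟩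
      s + (K * (18 + R) + K * (2 * suc (⟦ passCost ⟧ n)))
        ≡⟨ cong (s +_) (*-distribˡ-+ K (18 + R) _) ⟨
      s + K * ⟦ overhead p ⟧ n ∎)
    where
    open ≤-Reasoning
    n = order G
    K = 3 ^ ∣ X ∣
    R = ⟦ time delete ⊚ deletionSize ⊕ p ⊕ time initialise ⊚ dominatedSize ⟧ n
    regroup₁ : ∀ s a t b w → suc (2 + s + suc (a + suc (4 + t + suc (b + suc (w + 3)))))
                             ≡ s + (14 + (a + t + b) + w)
    regroup₁ = solve-∀
    regroup₂ : ∀ r k w → 14 + r + (2 * k * suc w + 4) ≡ 1 * (18 + r) + k * (2 * suc w)
    regroup₂ = solve-∀

theorem4p17 : (c : ℕ) (f : ℕ → ℕ)
    (𝒢 : GraphClass) → 𝒢 ⊆ Connected →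
    (k : Graph → ℕ)
    (𝒟 : GraphClass) → EfficientlyαDominated c 𝒟 →
    Solvable𝒪* (λ G → f (k G)) 𝒢 (OutputsSet (DeletionSet 𝒟 k)) →
    Solvable𝒪* (λ G → f (k G) + 3 ^ k G) 𝒢 (Decides HasIndependentCutset)
theorem4p17 c f 𝒢 _ k 𝒟 (dominate , C₂ , d₂ , dominates) (find , C₁ , d₁ , finds) =
  algorithm find dominate , C , d , solve
  where
  open Algorithm c
  -- `dominate` runs on `G − X`, whose order does not exceed that of `G`, so its time is restated in
  -- terms of the order of `G`.
  dominationTime : Polynomial
  dominationTime = con C₂ ⊗ power d₂ (con 1 ⊕ var)
  bound : PolynomiallyBounded (λ n → C₁ * suc n ^ d₁ + ⟦ overhead dominationTime ⟧ n)
  bound = bounded-+ {h = ⟦ overhead dominationTime ⟧} (C₁ , d₁ , λ _ → ≤-refl)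
            (⟦⟧-bounded (overhead dominationTime))
  C = proj₁ bound
  d = proj₁ (proj₂ bound)
  domination≤ : ∀ {m n t} → m ≤ n → t ≤ 1 * (C₂ * suc m ^ d₂) → t ≤ ⟦ dominationTime ⟧ n
  domination≤ {m} {n} {t} m≤n t≤ = begin
    t                        ≤⟨ t≤ ⟩
    1 * (C₂ * suc m ^ d₂)    ≡⟨ *-identityˡ _ ⟩
    C₂ * suc m ^ d₂          ≤⟨ *-monoʳ-≤ C₂ (^-monoˡ-≤ d₂ (s≤s m≤n)) ⟩
    C₂ * suc n ^ d₂          ≡⟨ cong (C₂ *_) (⟦power⟧ d₂ (con 1 ⊕ var) n) ⟨
    ⟦ dominationTime ⟧ n     ∎
    where open ≤-Reasoning
  -- `find` costs `F` times one polynomial and the rest `K` times another; the sum of the two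
  -- polynomials serves for both factors.
  total≤ : ∀ n F K {s u} → s ≤ F * (C₁ * suc n ^ d₁) → u ≤ s + K * ⟦ overhead dominationTime ⟧ n →
           u ≤ (F + K) * (C * suc n ^ d)
  total≤ n F K {s} {u} s≤ u≤ = begin
    u                        ≤⟨ u≤ ⟩
    s + K * O                ≤⟨ +-mono-≤ (≤-trans s≤ (*-monoʳ-≤ F (m≤m+n A O))) (*-monoʳ-≤ K (m≤n+m O A)) ⟩
    F * (A + O) + K * (A + O) ≡⟨ *-distribʳ-+ (A + O) F K ⟨
    (F + K) * (A + O)        ≤⟨ *-monoʳ-≤ (F + K) (proj₂ (proj₂ bound) n) ⟩
    (F + K) * (C * suc n ^ d) ∎
    where
    open ≤-Reasoning
    A = C₁ * suc n ^ d₁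
    O = ⟦ overhead dominationTime ⟧ n
  solve : ∀ G → 𝒢 G → ∃[ y ] ∃[ t ] (algorithm find dominate ⊢ encodeGraph G ⇓[ t ] y
    × Decides HasIndependentCutset G y × t ≤ (f (k G) + 3 ^ k G) * (C * suc (order G) ^ d))
  solve G G∈ with finds G G∈
  ... | _ , s , find↓ , (X , refl , ∣X∣≡k , G−X∈) , s≤ with dominates (G − X) G−X∈
  ... | _ , t , dominate↓ , (Y , refl , αdom) , t≤ =
    let u , ↓ , u≤ = algorithm-run (input G X Y) dominationTime find↓ dominate↓ (domination≤ (∣p∣≤n (∁ X)) t≤)
    in _ , u , ↓
     , (decision c G X Y , refl , fromEquivalence (decision-sound c G X Y) (decision-complete c G X Y αdom))
     , total≤ (order G) (f (k G)) (3 ^ k G) s≤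
         (subst (λ j → u ≤ s + 3 ^ j * ⟦ overhead dominationTime ⟧ (order G)) ∣X∣≡k u≤)
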